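{- LTL model checking is decidable for every completion-post-effective, $\infty$-completion-effective and positive-effective class $\mathcal{C}$ of positive very-WSTS: given $\mathcal{S}=(X,\xrightarrow{\Sigma},\le)\in\mathcal{C}$, an initial state $x_0\in X$ and an LTL formula $\varphi$ over the alphabet $\Sigma$, one can decide whether every infinite trace of $\mathcal{S}$ from $x_0$ satisfies $\varphi$.
   Context: A (labeled, ordered) transition system is $\mathcal{S}=(X,\xrightarrow{\Sigma},\le)$: $X$ a set, $\Sigma$ a finite alphabet, $\xrightarrow{a}\subseteq X\times X$, $\le$ a quasi-ordering; relations extend to words. Infinite traces from $x$: words $a_1a_2\cdots\in\Sigma^\omega$ with $x\xrightarrow{a_1}x_1\xrightarrow{a_2}x_2\cdots$ for some states $x_i$. $\mathrm{Post}(x,w)=\{y:x\xrightarrow{w}y\}$, extended to sets by union; $\downarrow D=\{x:\exists y\in D,\,x\le y\}$. WSTS: $\le$ a wqo and $x\xrightarrow{a}y$, $x'\ge x$ imply $x'\xrightarrow{w}y'\ge y$ for some $w$. Strong monotonicity: $x\xrightarrow{a}y$, $x'\ge x$ imply $x'\xrightarrow{a}y'$ with $y'\ge y$; strong-strict: additionally $x'>x$ gives $y'>y$. Deterministic: at most one $a$-successor. Ideals: nonempty downward-closed directed subsets, set $\mathrm{Idl}(X)$. Completion $\widehat{\mathcal{S}}=(\mathrm{Idl}(X),\Rightarrow_\Sigma,\subseteq)$ with $I\xRightarrow{a}J$ iff $J$ is a $\subseteq$-maximal ideal included in $\downarrow\mathrm{Post}(I,a)$; if deterministic, $w(I)$ is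 the unique $J$ with $I\xRightarrow{w}J$. $w^\infty(I)=\bigcup_kw^k(I)$ if $I\subset w(I)$, else $I$. Levels: $\mathrm{Idl}_0(X)=\mathrm{Idl}(X)$, $\mathrm{Idl}_n(X)$ = unions of strictly increasing sequences in $\mathrm{Idl}_{n-1}(X)$; finitely many levels if some $\mathrm{Idl}_n(X)=\emptyset$. Very-WSTS: WSTS with strong monotonicity whose completion is a deterministic WSTS ($\subseteq$ a wqo on ideals) with strong-strict monotonicity, and $\mathrm{Idl}(X)$ has finitely many levels. Positivity: $w$ is positive for $x$ if $x\xrightarrow{w}z$ for some $z\ge x$; $w$ is positive if positive for every $x$ with $\mathrm{Post}(x,w)\ne\emptyset$; $\mathcal{S}$ is positive if every word positive for some state is positive. Effectiveness: a class is completion-post-effective if ideals can be effectively represented and manipulated, inclusion of ideals is decidable, and completion successors of ideals are computable; $\infty$-completion-effective if $w^\infty(I)$ is computable for all ideals $I$ and words $w$; positive-effective if one can decide, given $\mathcal{S}\in\mathcal{C}$ and a finite automaton $A$ over $\Sigma$, whether the language of $A$ contains a positive word. -}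

module Defs where

open import Level using (Level; Lift; _⊔_; 0ℓ) renaming (suc to lsuc)
open import Data.Bool.Base using (Bool)
open import Data.Fin.Base using (Fin)
open import Data.Fin.Subset using (Subset) renaming (_∈_ to _∈ˢ_)
open import Data.List.Base using (List; []; _∷_; concat; replicate)
open import Data.List.Relation.Unary.All using (All)
open import Data.List.Relation.Unary.Any using (Any)
open import Data.Maybe.Base using (Maybe; just)
open import Data.Nat.Base as ℕ using (ℕ; zero; suc)
open import Data.Product.Base using (Σ-syntax; ∃-syntax; ∃₂; _×_)
open import Data.Sum.Base using (_⊎_)
open import Data.Unit.Base using (⊤)
open import Relation.Binary.Core using (Rel)
open import Relation.Binary.Structures using (IsPreorder)
open import Relation.Binary.PropositionalEquality using (_≡_; refl; isEquivalence)
open import Relation.Nullary.Negation.Core using (¬_)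
open import Relation.Nullary.Reflects using (Reflects)
open import Relation.Unary using (Pred; _∈_; _⊆_; _⊂_; _≐_)

private
  variable
    a c s o ℓ : Level

------------------------------------------------------------------------
-- Algorithms

-- A possibly diverging computation: p n is the output after n steps, if
-- there is one.  An element of this type carries no proof of termination,
-- so termination may be established classically without affecting what is
-- computed.

Partial : Set a → Set a
Partial A = ℕ → Maybe A

record _Computes_ {A : Set a} (p : Partial A) (Spec : Pred A ℓ) : Set (a ⊔ ℓ) where
  field
    halts   : ∃₂ λ n x → p n ≡ just x
    correct : ∀ n x → p n ≡ just x → Spec x

_Decides_ : Partial Bool → Set ℓ → Set ℓ
p Decides P = p Computes Reflects P

------------------------------------------------------------------------
-- Labelled ordered transition systems

record TransitionSystem (c s o : Level) : Set (lsuc (c ⊔ s ⊔ o)) where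
  infix 4 _⟶[_]_ _≤_ _<_ _⟶*[_]_
  infixr 5 _∷_
  field
    State      : Set c
    ∣Σ∣        : ℕ
    _⟶[_]_     : State → Fin ∣Σ∣ → State → Set s
    _≤_        : Rel State o
    isPreorder : IsPreorder _≡_ _≤_

  Letter : Set
  Letter = Fin ∣Σ∣

  Word : Set
  Word = List Letter

  _<_ : Rel State o
  x < y = x ≤ y × ¬ (y ≤ x)

  data _⟶*[_]_ : State → Word → State → Set (c ⊔ s) where
    []  : ∀ {x} → x ⟶*[ [] ] x
    _∷_ : ∀ {x y z a w} → x ⟶[ a ] y → y ⟶*[ w ] z → x ⟶*[ a ∷ w ] z

  IsInfiniteTrace : State → (ℕ → Letter) → Set (c ⊔ s)
  IsInfiniteTrace x σ =
    Σ[ xs ∈ (ℕ → State) ] xs 0 ≡ x × (∀ i → xs i ⟶[ σ i ] xs (suc i))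

  Post : Pred State ℓ → Letter → Pred State (c ⊔ s ⊔ ℓ)
  Post D a y = ∃[ x ] x ∈ D × x ⟶[ a ] y

  ↓ : Pred State ℓ → Pred State (c ⊔ o ⊔ ℓ)
  ↓ D x = ∃[ y ] y ∈ D × x ≤ y

  IsWQO : Set (c ⊔ o)
  IsWQO = ∀ (xs : ℕ → State) → ∃₂ λ i j → i ℕ.< j × xs i ≤ xs j

  Monotone : Set (c ⊔ s ⊔ o)
  Monotone = ∀ {x y x′ a} → x ⟶[ a ] y → x ≤ x′ →
    ∃₂ λ w y′ → x′ ⟶*[ w ] y′ × y ≤ y′

  StronglyMonotone : Set (c ⊔ s ⊔ o)
  StronglyMonotone = ∀ {x y x′ a} → x ⟶[ a ] y → x ≤ x′ →
    ∃[ y′ ] x′ ⟶[ a ] y′ × y ≤ y′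

  StrongStrictlyMonotone : Set (c ⊔ s ⊔ o)
  StrongStrictlyMonotone = StronglyMonotone ×
    (∀ {x y x′ a} → x ⟶[ a ] y → x < x′ → ∃[ y′ ] x′ ⟶[ a ] y′ × y < y′)

  IsWSTS : Set (c ⊔ s ⊔ o)
  IsWSTS = IsWQO × Monotone

  -- The notion of equality is a parameter because ideals have to be
  -- compared extensionally.
  Deterministic : Rel State ℓ → Set (c ⊔ s ⊔ ℓ)
  Deterministic _≈_ = ∀ {x y z a} → x ⟶[ a ] y → x ⟶[ a ] z → y ≈ z

  PositiveFor : Word → Pred State (c ⊔ s ⊔ o)
  PositiveFor w x = ∃[ z ] x ⟶*[ w ] z × x ≤ z

  PositiveWord : Pred Word (c ⊔ s ⊔ o)
  PositiveWord w = ∀ x → (∃[ y ] x ⟶*[ w ] y) → PositiveFor w x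

  IsPositive : Set (c ⊔ s ⊔ o)
  IsPositive = ∀ w → (∃[ x ] PositiveFor w x) → PositiveWord w

------------------------------------------------------------------------
-- Ideals and completion

module Completion (S : TransitionSystem 0ℓ 0ℓ 0ℓ) where
  open TransitionSystem S

  record IsIdeal (D : Pred State 0ℓ) : Set where
    field
      nonempty       : ∃[ x ] x ∈ D
      downwardClosed : ∀ {x y} → x ≤ y → y ∈ D → x ∈ D
      directed       : ∀ {x y} → x ∈ D → y ∈ D → ∃[ z ] z ∈ D × x ≤ z × y ≤ z

  record Ideal : Set₁ where
    field
      carrier : Pred State 0ℓ
      isIdeal : IsIdeal carrier

  open Ideal

  infix 4 _⊆ᴵ_ _⊂ᴵ_ _≐ᴵ_ _⇒[_]_

  _⊆ᴵ_ _⊂ᴵ_ _≐ᴵ_ : Rel Ideal 0ℓ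
  I ⊆ᴵ J = carrier I ⊆ carrier J
  I ⊂ᴵ J = carrier I ⊂ carrier J
  I ≐ᴵ J = carrier I ≐ carrier J

  _⇒[_]_ : Ideal → Letter → Ideal → Set₁
  I ⇒[ a ] J = carrier J ⊆ ↓ (Post (carrier I) a) ×
    (∀ K → carrier K ⊆ ↓ (Post (carrier I) a) → J ⊆ᴵ K → K ⊆ᴵ J)

  completion : TransitionSystem (lsuc 0ℓ) (lsuc 0ℓ) 0ℓ
  completion = record
    { State      = Ideal
    ; ∣Σ∣        = ∣Σ∣
    ; _⟶[_]_     = _⇒[_]_
    ; _≤_        = _⊆ᴵ_
    ; isPreorder = record
      { isEquivalence = isEquivalence
      ; reflexive     = λ { refl x∈I → x∈I }
      ; trans         = λ I⊆J J⊆K x∈I → J⊆K (I⊆J x∈I)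
      }
    }

  open TransitionSystem completion public
    using () renaming (_⟶*[_]_ to _⇒*[_]_)

  -- I ⊂ w(I); in particular w(I) is defined.
  Grows : Word → Pred Ideal (lsuc 0ℓ)
  Grows w I = ∃[ J ] I ⇒*[ w ] J × I ⊂ᴵ J

  -- The set of states w^∞(I); meaningful when the completion is
  -- deterministic, the J below being then w^k(I).
  _^∞_ : Word → Ideal → Pred State (lsuc 0ℓ)
  (w ^∞ I) x =
    (Grows w I × ∃₂ λ k J → I ⇒*[ concat (replicate k w) ] J × x ∈ carrier J)
    ⊎ (¬ Grows w I × x ∈ carrier I)

  Idl : ℕ → Pred Ideal (lsuc 0ℓ)
  Idl zero    I = Lift (lsuc 0ℓ) ⊤
  Idl (suc n) I = Σ[ Js ∈ (ℕ → Ideal) ] (∀ k → Js k ∈ Idl n) × (∀ k → Js k ⊂ᴵ Js (suc k)) ×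
    carrier I ≐ (λ x → ∃[ k ] x ∈ carrier (Js k))

  FinitelyManyLevels : Set₁
  FinitelyManyLevels = ∃[ n ] ∀ I → ¬ (I ∈ Idl n)

  record IsVeryWSTS : Set₁ where
    private module Ŝ = TransitionSystem completion
    field
      isWSTS                           : IsWSTS
      stronglyMonotone                 : StronglyMonotone
      completionIsWSTS                 : Ŝ.IsWSTS
      completionDeterministic          : Ŝ.Deterministic _≐ᴵ_
      completionStrongStrictlyMonotone : Ŝ.StrongStrictlyMonotone
      finitelyManyLevels               : FinitelyManyLevels

------------------------------------------------------------------------
-- Finite automata

record NFA (k : ℕ) : Set where
  field
    size    : ℕ
    initial : Subset size
    final   : Subset size
    next    : Fin size → Fin k → Subset size

  data AcceptsFrom : Fin size → List (Fin k) → Set where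
    stop : ∀ {q} → q ∈ˢ final → AcceptsFrom q []
    move : ∀ {q r a w} → r ∈ˢ next q a → AcceptsFrom r w → AcceptsFrom q (a ∷ w)

  Language : Pred (List (Fin k)) 0ℓ
  Language w = ∃[ q ] q ∈ˢ initial × AcceptsFrom q w

------------------------------------------------------------------------
-- Linear temporal logic over the alphabet Fin k

data LTL (k : ℕ) : Set where
  tt   : LTL k
  atom : Fin k → LTL k
  not  : LTL k → LTL k
  _and_ _until_ : LTL k → LTL k → LTL k
  next : LTL k → LTL k

infix 4 _at_⊨_ _⊨_

_at_⊨_ : ∀ {k} → (ℕ → Fin k) → ℕ → LTL k → Set
σ at i ⊨ tt          = ⊤
σ at i ⊨ atom a      = σ i ≡ a
σ at i ⊨ not φ       = ¬ (σ at i ⊨ φ)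
σ at i ⊨ (φ and ψ)   = (σ at i ⊨ φ) × (σ at i ⊨ ψ)
σ at i ⊨ next φ      = σ at suc i ⊨ φ
σ at i ⊨ (φ until ψ) = ∃[ j ] i ℕ.≤ j × (σ at j ⊨ ψ) ×
  (∀ m → i ℕ.≤ m → m ℕ.< j → σ at m ⊨ φ)

_⊨_ : ∀ {k} → (ℕ → Fin k) → LTL k → Set
σ ⊨ φ = σ at 0 ⊨ φ

------------------------------------------------------------------------
-- Classes of systems and their effectiveness

-- A class is given by names of its members; an algorithm receives a system
-- through its name.

record Class : Set₁ where
  field
    Name   : Set
    system : Name → TransitionSystem 0ℓ 0ℓ 0ℓ

  module Sys (S : Name) where
    open TransitionSystem (system S) public
    open Completion (system S) public

-- Representations of ideals together with the procedures an algorithm may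
-- call.  Their specifications are kept apart, in the properties of classes
-- below, so that an algorithm cannot extract data from proofs.

record Procedures (𝒞 : Class) : Set₁ where
  open Class 𝒞
  field
    IdealCode : Name → Set
    ⟦_⟧       : ∀ {S} → IdealCode S → Pred (Sys.State S) 0ℓ
    principal : ∀ S → Sys.State S → Partial (IdealCode S)
    included  : ∀ S → IdealCode S → IdealCode S → Partial Bool
    post      : ∀ S → IdealCode S → Sys.Letter S → Partial (List (IdealCode S))
    accel     : ∀ S → Sys.Word S → IdealCode S → Partial (IdealCode S)
    positive  : ∀ S → NFA (Sys.∣Σ∣ S) → Partial Bool

module Effectiveness (𝒞 : Class) (𝒫 : Procedures 𝒞) where
  open Class 𝒞
  open Procedures 𝒫
  open Completion.Ideal using (carrier)

  record CompletionPostEffective : Set₁ where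
    field
      isIdeal   : ∀ S (i : IdealCode S) → Sys.IsIdeal S ⟦ i ⟧
      allIdeals : ∀ S (I : Sys.Ideal S) → ∃[ i ] ⟦ i ⟧ ≐ carrier I

    ideal : ∀ S → IdealCode S → Sys.Ideal S
    ideal S i = record { carrier = ⟦ i ⟧ ; isIdeal = isIdeal S i }

    field
      principal-spec : ∀ S x → principal S x Computes
        λ i → ⟦ i ⟧ ≐ (λ y → Sys._≤_ S y x)
      included-spec  : ∀ S i j → included S i j Decides (⟦ i ⟧ ⊆ ⟦ j ⟧)
      -- The list contains exactly the successors, up to equality of ideals.
      post-spec      : ∀ S i a → post S i a Computes λ js →
        All (λ j → Sys._⇒[_]_ S (ideal S i) a (ideal S j)) js ×
        (∀ J → Sys._⇒[_]_ S (ideal S i) a J → Any (λ j → ⟦ j ⟧ ≐ carrier J) js)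

  ∞-CompletionEffective : Set₁
  ∞-CompletionEffective = ∀ S w i (I : Sys.Ideal S) → carrier I ≐ ⟦ i ⟧ →
    accel S w i Computes λ j → ⟦ j ⟧ ≐ Sys._^∞_ S w I

  PositiveEffective : Set
  PositiveEffective = ∀ S (A : NFA (Sys.∣Σ∣ S)) → positive S A Decides
    (∃[ w ] w ∈ NFA.Language A × w ∈ Sys.PositiveWord S)

-- Take the product of the system with a generalised Büchi automaton for the
-- violations of φ.  Accelerating ideals along words that loop on a state of
-- the automaton yields, because Idl(X) has finitely many levels and ⊆ is a
-- wqo, a finite set R of pairs (q , I) that is closed under successors up to
-- inclusion and only contains ideals of states covered in the product.  Once
-- R is closed, φ is violated iff some word w is positive and labels a fair
-- cycle of R all of whose steps are exact, i.e. I ⇒ J rather than I ⇒ K ⊆ J: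
-- such a w is enabled somewhere in I and can be repeated forever from a
-- covering reachable state.  Conversely a violating trace, followed in R,
-- returns to some (q , I) with a larger state; the word w read in between is
-- positive, so w(I) ⊇ I, and an inexact step would make w(I) ⊂ I by
-- strong-strict monotonicity.  No bound on R is known beforehand, so the
-- algorithm tries all numbers of moves until R is closed.
module Submission where

open import Defs
open import Level using (Level; lift; lower; _⊔_; 0ℓ) renaming (suc to lsuc)
open import Axiom.ExcludedMiddle using (ExcludedMiddle)
open import Data.Bool.Base using (Bool; true; false; if_then_else_; T; _∧_; _∨_) renaming (not to notᵇ)
open import Data.Bool.Properties as Bool using (T?; T-≡)
open import Data.Empty using (⊥; ⊥-elim)
open import Data.Fin.Base using (Fin; zero; suc)
open import Data.Fin.Properties using (_≟_; any?; all?)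
open import Data.Fin.Subset as Subset using (Subset; inside; outside; _∪_) renaming (_∈_ to _∈ˢ_)
open import Data.Fin.Subset.Properties as Subset using (x∈p∪q⁻; x∈p∪q⁺)
open import Data.List.Base using (List; []; _∷_; _++_; [_]; concat; replicate; map; filter; length; lookup; allFin; cartesianProduct; cartesianProductWith; null)
open import Data.List.Membership.Propositional using () renaming (_∈_ to _∈ˡ_; find to findˡ)
open import Data.List.Membership.Propositional.Properties using (∈-cartesianProduct⁺; ∈-cartesianProduct⁻; ∈-cartesianProductWith⁺; ∈-cartesianProductWith⁻; ∈-allFin; ∈-map⁺; ∈-map⁻; ∈-++⁺ˡ; ∈-++⁺ʳ; ∈-++⁻; ∈-filter⁺; ∈-filter⁻; ∈-lookup)
open import Data.List.Relation.Unary.All as All using ([]; _∷_)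
open import Data.List.Relation.Unary.Any using (here; there; index)
open import Data.List.Relation.Unary.Any.Properties using (lookup-index)
open import Data.Maybe.Base using (Maybe; just; nothing; _>>=_; _<∣>_)
open import Data.Nat.Base as ℕ using (ℕ; zero; suc; _+_; z≤n; s≤s)
open import Data.Nat.Properties as ℕ using ()
open import Data.Product.Base using (Σ-syntax; ∃-syntax; ∃₂; _×_; _,_; proj₁; proj₂)
open import Data.Product.Properties as Product using ()
open import Data.Sum.Base using (_⊎_; inj₁; inj₂; [_,_]′)
open import Data.Unit.Base using (⊤)
open import Data.Vec.Base as Vec using ()
open import Data.Vec.Properties as Vec using (lookup⇒[]=; []=⇒lookup; lookup∘tabulate)
open import Function.Base using (_∘_; id; case_of_)
open import Function.Bundles using (Equivalence)
open import Relation.Binary.Core using (Rel)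
open import Relation.Binary.Structures using (IsPreorder)
open import Relation.Binary.PropositionalEquality using (_≡_; refl; sym; trans; cong; subst; subst₂)
open import Relation.Nullary.Decidable using (Dec; yes; no; ⌊_⌋; does; proof; _because_; map′; toWitness; fromWitness; decidable-stable; _×-dec_; _⊎-dec_; _→-dec_)
open import Relation.Nullary.Negation.Core using (¬_; contradiction)
open import Relation.Nullary.Reflects using (Reflects; ofʸ; ofⁿ; invert; det; T-reflects; ¬-reflects; _×-reflects_; _⊎-reflects_; fromEquivalence)
open import Relation.Unary using (Pred; _∈_; _⊆_; _≐_)

-- Two gaps separate the search from its correctness. Termination has no computable bound: a finite
-- closed set is obtained classically, by turning the absence of an exploration into an infinite
-- branch. The algorithm is therefore a plain search, and excluded middle enters only when it is
-- proved correct. Moreover a stage of the search contains all nodes obtainable within its number of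
-- moves, not merely those of the exploration that is shown to exist, so closure of the exploration
-- does not immediately carry over to the stage. It is recovered from soundness: successors of the
-- stage consist of covered states, and by directedness an ideal of covered states already lies
-- within a single node of the exploration, which the stage contains.

private
  variable
    a b ℓ ℓ′ : Level
    A B : Set a

-- Partial computations

-- A `Partial` may lose or change its output at later step counts. The earliest output is stable, so
-- several computations can be compared at a common step count.
first : Partial A → Partial A
first p zero    = p zero
first p (suc n) = first p n <∣> p (suc n)

module _ {p : Partial A} where
  first-sound : ∀ n {x} → first p n ≡ just x → ∃[ k ] p k ≡ just x
  first-sound zero    eq = zero , eq
  first-sound (suc n) eq with first p n in eq′
  ... | just _  = first-sound n (trans eq′ eq)
  ... | nothing = suc n , eq

  first-stable : ∀ {m n x} → first p m ≡ just x → m ℕ.≤ n → first p n ≡ just x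
  first-stable eq m≤n = go eq (ℕ.≤⇒≤′ m≤n)
    where
    go : ∀ {m n x} → first p m ≡ just x → m ℕ.≤′ n → first p n ≡ just x
    go eq ℕ.≤′-refl       = eq
    go eq (ℕ.≤′-step m≤n) rewrite go eq m≤n = refl

  first-halts : ∀ n {x} → p n ≡ just x → ∃[ y ] first p n ≡ just y
  first-halts zero    eq = _ , eq
  first-halts (suc n) eq with first p n
  ... | just y  = y , refl
  ... | nothing = _ , eq

infixl 1 _>>=ᴾ_
_>>=ᴾ_ : Partial A → (A → Partial B) → Partial B
(p >>=ᴾ f) n = first p n >>= λ x → first (f x) n

returnᴾ : A → Partial A
returnᴾ x n = just x

concatMapᴾ : (A → Partial (List B)) → List A → Partial (List B)
concatMapᴾ f []       = returnᴾ []
concatMapᴾ f (x ∷ xs) = f x >>=ᴾ λ ys → concatMapᴾ f xs >>=ᴾ λ zs → returnᴾ (ys ++ zs)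

tabulateᴾ : ∀ {n} → (Fin n → Partial A) → Partial (Fin n → A)
tabulateᴾ {n = zero}  f = returnᴾ λ ()
tabulateᴾ {n = suc n} f = f zero >>=ᴾ λ x → tabulateᴾ (f ∘ suc) >>=ᴾ λ g →
  returnᴾ λ { zero → x ; (suc i) → g i }

-- Dovetailing: all candidates up to `n` are run for `n` steps, so a slow candidate does not block
-- later ones. An output `nothing` rejects a candidate.
searchᴾ : (ℕ → Partial (Maybe A)) → Partial A
searchᴾ f n = first (λ k → first (f k) n >>= id) n

open _Computes_

weaken : {p : Partial A} {P : Pred A ℓ} {Q : Pred A ℓ′} → P ⊆ Q → p Computes P → p Computes Q
weaken P⊆Q c .halts            = c .halts
weaken P⊆Q c .correct n x eq = P⊆Q (c .correct n x eq)

return-computes : {P : Pred A ℓ} {x : A} → P x → returnᴾ x Computes P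
return-computes Px .halts              = 0 , _ , refl
return-computes Px .correct _ _ refl = Px

>>=-computes : {p : Partial A} {f : A → Partial B} {P : Pred A ℓ} {Q : Pred B ℓ′} →
  p Computes P → (∀ {x} → P x → f x Computes Q) → (p >>=ᴾ f) Computes Q
>>=-computes {p = p} {f = f} cp cf .halts
  with m , _ , eq ← cp .halts
  with x , eqp ← first-halts m eq
  with k , eqk ← first-sound m eqp
  with l , _ , eq′ ← cf (cp .correct k x eqk) .halts
  with y , eqf ← first-halts l eq′
  = m ℕ.⊔ l , y , eqn
  where
  eqn : (p >>=ᴾ f) (m ℕ.⊔ l) ≡ just y
  eqn rewrite first-stable {p = p} eqp (ℕ.m≤m⊔n m l) = first-stable {p = f x} eqf (ℕ.m≤n⊔m m l)
>>=-computes {p = p} {f = f} cp cf .correct n y eq with first p n in eqp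
... | just x with k , eqk ← first-sound {p = p} n eqp | l , eql ← first-sound {p = f x} n eq
  = cf (cp .correct k x eqk) .correct l y eql

Collects : {A : Set a} {B : Set b} → (A → Pred (List B) ℓ) → List A → Pred (List B) (a ⊔ b ⊔ ℓ)
Collects P xs ys =
  (∀ {x} → x ∈ˡ xs → ∃[ zs ] P x zs × (∀ y → y ∈ˡ zs → y ∈ˡ ys)) ×
  (∀ {y} → y ∈ˡ ys → ∃₂ λ x zs → x ∈ˡ xs × P x zs × y ∈ˡ zs)

concatMap-computes : {f : A → Partial (List B)} {P : A → Pred (List B) ℓ} →
  (∀ x → f x Computes P x) → ∀ xs → concatMapᴾ f xs Computes Collects P xs
concatMap-computes cf []       = return-computes ((λ ()) , (λ ()))
concatMap-computes cf (x ∷ xs) = >>=-computes (cf x) λ {ys} Pys →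
  >>=-computes (concatMap-computes cf xs) λ {zs} (to , from) → return-computes
    ( (λ { (here refl) → ys , Pys , λ _ → ∈-++⁺ˡ
         ; (there x∈)  → case to x∈ of λ (vs , Pvs , vs⊆) → vs , Pvs , λ y → ∈-++⁺ʳ ys ∘ vs⊆ y })
    , (λ y∈ → [ (λ y∈ys → x , ys , here refl , Pys , y∈ys)
              , (λ y∈zs → case from y∈zs of λ (x′ , vs , x′∈ , Pvs , y∈vs) → x′ , vs , there x′∈ , Pvs , y∈vs)
              ]′ (∈-++⁻ ys y∈)) )

tabulate-computes : ∀ {n} {f : Fin n → Partial A} {P : Fin n → Pred A ℓ} →
  (∀ i → f i Computes P i) → tabulateᴾ f Computes λ g → ∀ i → P i (g i)
tabulate-computes {n = zero}  cf = return-computes λ ()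
tabulate-computes {n = suc n} cf = >>=-computes (cf zero) λ Px →
  >>=-computes (tabulate-computes (cf ∘ suc)) λ Pg →
    return-computes λ { zero → Px ; (suc i) → Pg i }

-- Halting rests on one index that cannot answer `nothing`. The result may come from another index,
-- which is harmless because every `just` yields `Q`.
search-computes : {f : ℕ → Partial (Maybe A)} {P : ℕ → Pred (Maybe A) ℓ} {Q : Pred A ℓ′} →
  (∀ k → f k Computes P k) → (∀ {k x} → P k (just x) → Q x) →
  (∃[ k ] ¬ P k nothing) → searchᴾ f Computes Q
search-computes {f = f} cf P⇒Q (k , ¬P) .halts
  with m , _ , eq ← cf k .halts
  with r , eqr ← first-halts m eq
  with l , eql ← first-sound m eqr
  with r | cf k .correct l r eql
... | nothing | P = contradiction P ¬P
... | just x  | _ = n , g-halts .proj₁ , first-stable {p = g} (g-halts .proj₂) (ℕ.m≤m⊔n k m)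
  where
  n = k ℕ.⊔ m
  g = λ j → first (f j) n >>= id
  gk : g k ≡ just x
  gk rewrite first-stable {p = f k} eqr (ℕ.m≤n⊔m k m) = refl
  g-halts = first-halts {p = g} k gk
search-computes {f = f} cf P⇒Q _ .correct n x eq
  with k , eqk ← first-sound n eq
  with first (f k) n in eqf
... | just (just x) with refl ← eqk | m , eqm ← first-sound {p = f k} n eqf
  = P⇒Q (cf k .correct m (just x) eqm)

-- Walks in labelled graphs

slice : {L : Set} → (ℕ → L) → ℕ → List L
slice σ zero    = []
slice σ (suc n) = σ 0 ∷ slice (σ ∘ suc) n

module Walks {V L : Set} (E : V → L → V → Set ℓ) where
  infixr 5 _∷_ _++ʷ_

  data Walk : V → List L → V → Set ℓ where
    []  : ∀ {u} → Walk u [] u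
    _∷_ : ∀ {u v t a w} → E u a v → Walk v w t → Walk u (a ∷ w) t

  data Visits (P : V → Set) : ∀ {u w t} → Walk u w t → Set ℓ where
    here  : ∀ {u v t a w} {e : E u a v} {p : Walk v w t} → P u → Visits P (e ∷ p)
    there : ∀ {u v t a w} {e : E u a v} {p : Walk v w t} → Visits P p → Visits P (e ∷ p)

  _++ʷ_ : ∀ {u v t w w′} → Walk u w v → Walk v w′ t → Walk u (w ++ w′) t
  []      ++ʷ q = q
  (e ∷ p) ++ʷ q = e ∷ (p ++ʷ q)

  replicateʷ : ∀ {u w} → Walk u w u → ∀ k → Walk u (concat (replicate k w)) u
  replicateʷ p zero    = []
  replicateʷ p (suc k) = p ++ʷ replicateʷ p k

  IsInfiniteWalk : (ℕ → V) → (ℕ → L) → Set ℓ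
  IsInfiniteWalk vs σ = ∀ i → E (vs i) (σ i) (vs (suc i))

  take-walk : ∀ (vs : ℕ → V) σ n → (∀ i → i ℕ.< n → E (vs i) (σ i) (vs (suc i))) → Walk (vs 0) (slice σ n) (vs n)
  take-walk vs σ zero    es = []
  take-walk vs σ (suc n) es = es 0 (s≤s z≤n) ∷ take-walk (vs ∘ suc) (σ ∘ suc) n (λ i → es (suc i) ∘ s≤s)

  take-visits : ∀ {P : V → Set} (vs : ℕ → V) σ n (es : ∀ i → i ℕ.< n → E (vs i) (σ i) (vs (suc i))) {i} →
    i ℕ.< n → P (vs i) → Visits P (take-walk vs σ n es)
  take-visits vs σ (suc n) es {zero}  _         Pi = here Pi
  take-visits vs σ (suc n) es {suc i} (s≤s i<n) Pi = there (take-visits (vs ∘ suc) (σ ∘ suc) n (λ i → es (suc i) ∘ s≤s) i<n Pi)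

  -- Keeping the first edge apart makes a lap nonempty, so that unrolling always has a next edge to
  -- offer.
  record Lap {C : Set} (P : C → V → Set) (Inv : V → Set) (v : V) : Set ℓ where
    field
      {letter}  : L
      {word}    : List L
      {mid end} : V
      edge      : E v letter mid
      rest      : Walk mid word end
      visits    : ∀ c → Visits (P c) (edge ∷ rest)
      invariant : Inv end

  module Unroll {C : Set} {P : C → V → Set} {Inv : V → Set} (lap : ∀ {v} → Inv v → Lap P Inv v) where

    infix 4 _to_
    -- The unread remainder of the current lap; once it is exhausted, the invariant at its end
    -- supplies the next lap.
    record Position : Set ℓ where
      constructor _to_
      field
        {current end} : V
        {word}        : List L
        walk          : Walk current word end
        invariant     : Inv end

    open Position
    private module Lap′ {v} (i : Inv v) = Lap (lap i)

    letter : Position → L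
    letter ([] to i)                = Lap′.letter i
    letter (_∷_ {a = a} _ _ to _) = a

    advance : Position → Position
    advance ([] to i)    = Lap′.rest i to Lap′.invariant i
    advance (_ ∷ p to i) = p to i

    edge : ∀ s → E (current s) (letter s) (current (advance s))
    edge ([] to i)    = Lap′.edge i
    edge (e ∷ _ to _) = e

    iterate : Position → ℕ → Position
    iterate s zero    = s
    iterate s (suc n) = iterate (advance s) n

    vertices : Position → ℕ → V
    vertices s = current ∘ iterate s

    word∞ : Position → ℕ → L
    word∞ s = letter ∘ iterate s

    isInfiniteWalk : ∀ s → IsInfiniteWalk (vertices s) (word∞ s)
    isInfiniteWalk s zero    = edge s
    isInfiniteWalk s (suc n) = isInfiniteWalk (advance s) n

    visited : ∀ {c u w t} (p : Walk u w t) (i : Inv t) → Visits (P c) p → ∃[ n ] P c (vertices (p to i) n)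
    visited (_ ∷ _) i (here Pu) = zero , Pu
    visited (_ ∷ p) i (there v) with n , Pn ← visited p i v = suc n , Pn

    -- The remainder of the current lap may miss `P c`, but the lap after it is complete.
    revisited : ∀ c {u w t} (p : Walk u w t) (i : Inv t) → ∃[ n ] P c (vertices (p to i) n)
    revisited c []      i with Lap′.visits i c
    ... | here Pu = zero , Pu
    ... | there v with n , Pn ← visited _ _ v = suc n , Pn
    revisited c (_ ∷ p) i with n , Pn ← revisited c p i = suc n , Pn

    infinitelyOften : ∀ c s i → ∃[ j ] i ℕ.≤ j × P c (vertices s j)
    infinitelyOften c (p to i) zero    with n , Pn ← revisited c p i = n , z≤n , Pn
    infinitelyOften c s        (suc i) with j , i≤j , Pj ← infinitelyOften c (advance s) i = suc j , s≤s i≤j , Pj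

open Walks using ([]; _∷_; here; there)

module _ {V L : Set} {E : V → L → V → Set ℓ} {E′ : V → L → V → Set ℓ′} (f : ∀ {u a v} → E u a v → E′ u a v) where
  map-walk : ∀ {u w v} → Walks.Walk E u w v → Walks.Walk E′ u w v
  map-walk []      = []
  map-walk (e ∷ p) = f e ∷ map-walk p

  map-visits : ∀ {P : V → Set} {u w v} {p : Walks.Walk E u w v} → Walks.Visits E P p → Walks.Visits E′ P (map-walk p)
  map-visits (here Pu) = here Pu
  map-visits (there v) = there (map-visits v)

walk? : ∀ {n} {L : Set} {E : Fin n → L → Fin n → Set} → (∀ u a v → Dec (E u a v)) →
  ∀ u w v → Dec (Walks.Walk E u w v)
walk? E? u []      v = map′ (λ { refl → [] }) (λ { [] → refl }) (u ≟ v)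
walk? E? u (a ∷ w) v =
  map′ (λ { (_ , e , p) → e ∷ p }) (λ { (e ∷ p) → _ , e , p })
    (any? λ u′ → E? u a u′ ×-dec walk? E? u′ w v)

upperBound : ∀ {n} (f : Fin n → ℕ) → ∃[ m ] ∀ i → f i ℕ.≤ m
upperBound {zero}  f = 0 , λ ()
upperBound {suc n} f with m , f≤m ← upperBound (f ∘ suc) =
  f zero ℕ.⊔ m , λ { zero → ℕ.m≤m⊔n _ _ ; (suc i) → ℕ.≤-trans (f≤m i) (ℕ.m≤n⊔m _ _) }

module Iterate (h : ℕ → ℕ) (h-inc : ∀ n → n ℕ.< h n) where
  iterate : ℕ → ℕ → ℕ
  iterate n zero    = n
  iterate n (suc k) = h (iterate n k)

  -- Between two iterates fits a whole application of `h`, even if `h` is not monotone. With `h`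
  -- chosen as a waiting time, everything awaited happens between any two iterates.
  iterate-< : ∀ n {i j} → i ℕ.< j → h (iterate n i) ℕ.≤ iterate n j
  iterate-< n i<j = go (ℕ.≤⇒≤′ i<j)
    where
    go : ∀ {i j} → suc i ℕ.≤′ j → h (iterate n i) ℕ.≤ iterate n j
    go ℕ.≤′-refl     = ℕ.≤-refl
    go (ℕ.≤′-step p) = ℕ.≤-trans (go p) (ℕ.<⇒≤ (h-inc _))

module Classical (em : ExcludedMiddle (lsuc 0ℓ)) where
  em₀ : ExcludedMiddle 0ℓ
  em₀ = map′ lower lift em

  -- If each value stopped occurring at some position, the value of `f` at a common upper bound of
  -- these positions would be a contradiction.
  infinitePigeonhole : ∀ {n} (f : ℕ → Fin n) → ∃[ v ] ∀ N → ∃[ k ] N ℕ.≤ k × f k ≡ v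
  infinitePigeonhole f = decidable-stable em₀ λ ¬∃ →
    let last : ∀ v → ∃[ N ] ¬ (∃[ k ] N ℕ.≤ k × f k ≡ v)
        last v = decidable-stable em₀ λ ¬last →
          ¬∃ (v , λ N → decidable-stable em₀ λ ¬k → ¬last (N , ¬k))
        m , N≤m = upperBound (proj₁ ∘ last)
    in last (f m) .proj₂ (m , N≤m (f m) , refl)

  -- Along the subsequence where `f` takes one infinitely recurring value, the wqo alone provides
  -- the pair.
  wqo-pair : {A : Set a} {R : Rel A ℓ} → (∀ (xs : ℕ → A) → ∃₂ λ i j → i ℕ.< j × R (xs i) (xs j)) →
    ∀ {n} (f : ℕ → Fin n) (xs : ℕ → A) → ∃₂ λ i j → i ℕ.< j × f i ≡ f j × R (xs i) (xs j)
  wqo-pair wqo f xs =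
    let v , often   = infinitePigeonhole f
        pick n      = often n .proj₁
        open Iterate (λ n → pick (suc n)) (λ n → often (suc n) .proj₂ .proj₁)
        g           = iterate (pick 0)
        fg≡v        : ∀ i → f (g i) ≡ v
        fg≡v        = λ { zero → often 0 .proj₂ .proj₂ ; (suc i) → often (suc (g i)) .proj₂ .proj₂ }
        i , j , i<j , Rij = wqo (xs ∘ g)
    in g i , g j
     , ℕ.≤-trans (often (suc (g i)) .proj₂ .proj₁) (iterate-< (pick 0) i<j)
     , trans (fg≡v i) (sym (fg≡v j)) , Rij

-- Automata

subsets : ∀ n → List (Subset n)
subsets zero    = [ Vec.[] ]
subsets (suc n) = map (inside Vec.∷_) (subsets n) ++ map (outside Vec.∷_) (subsets n)

∈-subsets : ∀ {n} (p : Subset n) → p ∈ˡ subsets n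
∈-subsets Vec.[]              = here refl
∈-subsets (inside Vec.∷ p)  = ∈-++⁺ˡ (∈-map⁺ _ (∈-subsets p))
∈-subsets (outside Vec.∷ p) = ∈-++⁺ʳ (map _ (subsets _)) (∈-map⁺ _ (∈-subsets p))

∈-tabulate⁺ : ∀ {n} {P : Pred (Fin n) ℓ} (P? : ∀ i → Dec (P i)) {i} → P i → i ∈ˢ Vec.tabulate (⌊_⌋ ∘ P?)
∈-tabulate⁺ P? {i} Pi = lookup⇒[]= i _
  (trans (lookup∘tabulate _ i) (Equivalence.to T-≡ (fromWitness {a? = P? i} Pi)))

∈-tabulate⁻ : ∀ {n} {P : Pred (Fin n) ℓ} (P? : ∀ i → Dec (P i)) {i} → i ∈ˢ Vec.tabulate (⌊_⌋ ∘ P?) → P i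
∈-tabulate⁻ P? {i} i∈ = toWitness {a? = P? i}
  (Equivalence.from T-≡ (trans (sym (lookup∘tabulate _ i)) ([]=⇒lookup i∈)))

-- States are positions in `xs`. An element may occupy several positions, so runs are read off by
-- `lookup` and built through one chosen position `code`.
module FiniteNFA {k : ℕ} {A : Set} (xs : List A) (complete : ∀ x → x ∈ˡ xs)
  {I F : Pred A 0ℓ} (I? : ∀ x → Dec (I x)) (F? : ∀ x → Dec (F x))
  {δ : A → Fin k → A → Set} (δ? : ∀ x c y → Dec (δ x c y)) where

  open Walks δ using (Walk)

  nfa : NFA k
  nfa = record
    { size    = length xs
    ; initial = Vec.tabulate (⌊_⌋ ∘ I? ∘ lookup xs)
    ; final   = Vec.tabulate (⌊_⌋ ∘ F? ∘ lookup xs)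
    ; next    = λ i c → Vec.tabulate (⌊_⌋ ∘ δ? (lookup xs i) c ∘ lookup xs)
    }

  private
    code : A → Fin (length xs)
    code x = index (complete x)

    decode-code : ∀ x → lookup xs (code x) ≡ x
    decode-code x = sym (lookup-index (complete x))

    accepted⁻ : ∀ {i w} → NFA.AcceptsFrom nfa i w → ∃[ y ] F y × Walk (lookup xs i) w y
    accepted⁻ (NFA.stop i∈F) = _ , ∈-tabulate⁻ (F? ∘ lookup xs) i∈F , []
    accepted⁻ (NFA.move j∈δ p) with y , Fy , q ← accepted⁻ p =
      y , Fy , ∈-tabulate⁻ (δ? _ _ ∘ lookup xs) j∈δ ∷ q

    accepted⁺ : ∀ {x w y} → Walk x w y → F y → NFA.AcceptsFrom nfa (code x) w
    accepted⁺ {x} []      Fx = NFA.stop (∈-tabulate⁺ (F? ∘ lookup xs) (subst F (sym (decode-code x)) Fx))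
    accepted⁺ {x} (_∷_ {v = y} {a = c} e p) Fy =
      NFA.move (∈-tabulate⁺ (δ? _ _ ∘ lookup xs) {code y} e′) (accepted⁺ p Fy)
      where
      e′ : δ (lookup xs (code x)) c (lookup xs (code y))
      e′ rewrite decode-code x | decode-code y = e

  language⁻ : ∀ {w} → w ∈ NFA.Language nfa → ∃₂ λ x y → I x × F y × Walk x w y
  language⁻ (i , i∈I , p) with y , Fy , q ← accepted⁻ p =
    _ , y , ∈-tabulate⁻ (I? ∘ lookup xs) i∈I , Fy , q

  language⁺ : ∀ {x w y} → I x → F y → Walk x w y → w ∈ NFA.Language nfa
  language⁺ {x} Ix Fy p =
    code x , ∈-tabulate⁺ (I? ∘ lookup xs) (subst I (sym (decode-code x)) Ix) , accepted⁺ p Fy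

-- The second component of a state collects the marks met so far.
module CycleNFA {r k m : ℕ} {E : Fin r → Fin k → Fin r → Set} (E? : ∀ u c v → Dec (E u c v))
  (marks : Fin r → Subset m) (v₀ : Fin r) where

  open Walks E using (Walk; Visits)

  private
    State : Set
    State = Fin r × Subset m

    -- Marks are collected on leaving a vertex, in agreement with `Visits`, which looks at the
    -- sources of edges.
    δ : State → Fin k → State → Set
    δ (u , f) c (v , g) = E u c v × g ≡ f ∪ marks u

    _≟ˢ_ : (f g : Subset m) → Dec (f ≡ g)
    _≟ˢ_ = Vec.≡-dec Bool._≟_

    _≟ᵖ_ : (s t : State) → Dec (s ≡ t)
    _≟ᵖ_ = Product.≡-dec _≟_ _≟ˢ_

    module Flagged = FiniteNFA (cartesianProduct (allFin r) (subsets m))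
      (λ (v , f) → ∈-cartesianProduct⁺ (∈-allFin v) (∈-subsets f))
      (_≟ᵖ (v₀ , Subset.⊥)) (_≟ᵖ (v₀ , Subset.⊤))
      (λ (u , f) c (v , g) → E? u c v ×-dec (g ≟ˢ (f ∪ marks u)))

    project : ∀ {u f w v} → Walks.Walk δ (u , f) w (v , Subset.⊤) →
      Σ[ p ∈ Walk u w v ] ∀ c → c ∈ˢ f ⊎ Visits (λ t → c ∈ˢ marks t) p
    project []               = [] , λ c → inj₁ Subset.∈⊤
    project {f = f} ((e , refl) ∷ p) with q , met ← project p = e ∷ q , λ c →
      [ (λ c∈ → [ inj₁ , inj₂ ∘ here ]′ (x∈p∪q⁻ f _ c∈)) , inj₂ ∘ there ]′ (met c)

    lift-walk : ∀ {u f w v} (p : Walk u w v) → (∀ c → c ∈ˢ f ⊎ Visits (λ t → c ∈ˢ marks t) p) →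
      Walks.Walk δ (u , f) w (v , Subset.⊤)
    -- An empty walk visits nothing, so all marks are already in `f`.
    lift-walk {f = f} [] met
      rewrite Subset.⊆-antisym {i = f} (Subset.⊆-max f) (λ {c} _ → [ id , (λ ()) ]′ (met c)) = []
    lift-walk {f = f} (e ∷ p) met = (e , refl) ∷ lift-walk p λ c →
      [ inj₁ ∘ x∈p∪q⁺ ∘ inj₁
      , (λ { (here c∈) → inj₁ (x∈p∪q⁺ {p = f} (inj₂ c∈)) ; (there v) → inj₂ v }) ]′ (met c)

  nfa : NFA k
  nfa = Flagged.nfa

  cycle⁻ : ∀ {w} → w ∈ NFA.Language nfa → Σ[ p ∈ Walk v₀ w v₀ ] ∀ c → Visits (λ t → c ∈ˢ marks t) p
  cycle⁻ w∈ with _ , _ , refl , refl , p ← Flagged.language⁻ w∈ with q , met ← project p =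
    q , λ c → [ (λ c∈⊥ → contradiction c∈⊥ Subset.∉⊥) , id ]′ (met c)

  cycle⁺ : ∀ {w} (p : Walk v₀ w v₀) → (∀ c → Visits (λ t → c ∈ˢ marks t) p) → w ∈ NFA.Language nfa
  cycle⁺ p met = Flagged.language⁺ refl refl (lift-walk p (inj₂ ∘ met))

-- Generalised Büchi acceptance on states. Several conditions are kept because a tableau has one per
-- `until` subformula, and `CycleNFA` can check them all on one cycle.
record Automaton (k : ℕ) : Set₁ where
  field
    size conditions : ℕ
    Initial         : Pred (Fin size) 0ℓ
    initial?        : ∀ q → Dec (Initial q)
    Step            : Fin size → Fin k → Fin size → Set
    step?           : ∀ q c r → Dec (Step q c r)
    marks           : Fin size → Subset conditions

  Accepts : (ℕ → Fin k) → Set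
  Accepts σ = Σ[ qs ∈ (ℕ → Fin size) ] Initial (qs 0) × Walks.IsInfiniteWalk Step qs σ ×
    ∀ c i → ∃[ j ] i ℕ.≤ j × c ∈ˢ marks (qs j)

-- Linear temporal logic

Reflects-map : ∀ {b} → (A → B) → (B → A) → Reflects A b → Reflects B b
Reflects-map f g r = proof (map′ f g (_ because r))

module _ {b} (r : Reflects A b) where
  reflects-to : A → b ≡ true
  reflects-to x = det r (ofʸ x)

  reflects-from : b ≡ true → A
  reflects-from refl = invert r

module Tableau {k : ℕ} where

  until-unfold : ∀ {φ ψ : LTL k} {σ i} → σ at i ⊨ (φ until ψ) → σ at i ⊨ ψ ⊎ σ at i ⊨ φ × σ at suc i ⊨ (φ until ψ)
  until-unfold (j , i≤j , ψj , φ<j) with ℕ.m≤n⇒m<n∨m≡n i≤j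
  ... | inj₁ i<j  = inj₂ (φ<j _ ℕ.≤-refl i<j , j , i<j , ψj , λ m i<m → φ<j m (ℕ.<⇒≤ i<m))
  ... | inj₂ refl = inj₁ ψj

  until-fold : ∀ {φ ψ : LTL k} {σ i} → σ at i ⊨ ψ ⊎ σ at i ⊨ φ × σ at suc i ⊨ (φ until ψ) → σ at i ⊨ (φ until ψ)
  until-fold {i = i} (inj₁ ψi) = i , ℕ.≤-refl , ψi , λ m i≤m m<i → contradiction m<i (ℕ.≤⇒≯ i≤m)
  until-fold {φ = φ} {σ = σ} {i = i} (inj₂ (φi , j , i<j , ψj , φ<j)) = j , ℕ.<⇒≤ i<j , ψj , φ<j′
    where
    φ<j′ : ∀ m → i ℕ.≤ m → m ℕ.< j → σ at m ⊨ φ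
    φ<j′ m i≤m m<j with ℕ.m≤n⇒m<n∨m≡n i≤m
    ... | inj₁ i<m  = φ<j m i<m m<j
    ... | inj₂ refl = φi

  -- A state guesses which temporal subformulas hold now.
  St : LTL k → Set
  St tt          = ⊤
  St (atom a)    = Bool
  St (not φ)     = St φ
  St (φ and ψ)   = St φ × St ψ
  St (next φ)    = Bool × St φ
  St (φ until ψ) = Bool × St φ × St ψ

  holds : ∀ φ → St φ → Bool
  holds tt          s           = true
  holds (atom a)    s           = s
  holds (not φ)     s           = notᵇ (holds φ s)
  holds (φ and ψ)   (s , t)     = holds φ s ∧ holds ψ t
  holds (next φ)    (b , s)     = b
  holds (φ until ψ) (b , s , t) = b

  Succ : ∀ φ → St φ → Fin k → St φ → Set
  Succ tt          _           c _              = ⊤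
  Succ (atom a)    s           c _              = s ≡ does (c ≟ a)
  Succ (not φ)     s           c s′             = Succ φ s c s′
  Succ (φ and ψ)   (s , t)     c (s′ , t′)      = Succ φ s c s′ × Succ ψ t c t′
  Succ (next φ)    (b , s)     c (_ , s′)       = b ≡ holds φ s′ × Succ φ s c s′
  Succ (φ until ψ) (b , s , t) c (b′ , s′ , t′) =
    b ≡ holds ψ t ∨ (holds φ s ∧ b′) × Succ φ s c s′ × Succ ψ t c t′

  succ? : ∀ φ s c s′ → Dec (Succ φ s c s′)
  succ? tt          _           c _              = yes _
  succ? (atom a)    s           c _              = s Bool.≟ _
  succ? (not φ)     s           c s′             = succ? φ s c s′
  succ? (φ and ψ)   (s , t)     c (s′ , t′)      = succ? φ s c s′ ×-dec succ? ψ t c t′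
  succ? (next φ)    (b , s)     c (_ , s′)       = b Bool.≟ _ ×-dec succ? φ s c s′
  succ? (φ until ψ) (b , s , t) c (b′ , s′ , t′) =
    b Bool.≟ _ ×-dec succ? φ s c s′ ×-dec succ? ψ t c t′

  Obligation : LTL k → Set
  Obligation tt          = ⊥
  Obligation (atom a)    = ⊥
  Obligation (not φ)     = Obligation φ
  Obligation (φ and ψ)   = Obligation φ ⊎ Obligation ψ
  Obligation (next φ)    = Obligation φ
  Obligation (φ until ψ) = ⊤ ⊎ (Obligation φ ⊎ Obligation ψ)

  -- The expansion law in `Succ` also admits guessing that an `until` holds while its goal is
  -- postponed forever. Recurrent fulfilment excludes this: infinitely often the guess is negative
  -- or the goal holds.
  Fulfilled : ∀ φ → Obligation φ → St φ → Set
  Fulfilled (not φ)     o               s           = Fulfilled φ o s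
  Fulfilled (φ and ψ)   (inj₁ o)        (s , t)     = Fulfilled φ o s
  Fulfilled (φ and ψ)   (inj₂ o)        (s , t)     = Fulfilled ψ o t
  Fulfilled (next φ)    o               (b , s)     = Fulfilled φ o s
  Fulfilled (φ until ψ) (inj₁ _)        (b , s , t) = b ≡ true → holds ψ t ≡ true
  Fulfilled (φ until ψ) (inj₂ (inj₁ o)) (b , s , t) = Fulfilled φ o s
  Fulfilled (φ until ψ) (inj₂ (inj₂ o)) (b , s , t) = Fulfilled ψ o t

  fulfilled? : ∀ φ o s → Dec (Fulfilled φ o s)
  fulfilled? (not φ)     o               s           = fulfilled? φ o s
  fulfilled? (φ and ψ)   (inj₁ o)        (s , t)     = fulfilled? φ o s
  fulfilled? (φ and ψ)   (inj₂ o)        (s , t)     = fulfilled? ψ o t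
  fulfilled? (next φ)    o               (b , s)     = fulfilled? φ o s
  fulfilled? (φ until ψ) (inj₁ _)        (b , s , t) = b Bool.≟ true →-dec holds ψ t Bool.≟ true
  fulfilled? (φ until ψ) (inj₂ (inj₁ o)) (b , s , t) = fulfilled? φ o s
  fulfilled? (φ until ψ) (inj₂ (inj₂ o)) (b , s , t) = fulfilled? ψ o t

  IsRun : ∀ φ → (ℕ → Fin k) → (ℕ → St φ) → Set
  IsRun φ σ ρ = ∀ i → Succ φ (ρ i) (σ i) (ρ (suc i))

  IsFair : ∀ φ → (ℕ → St φ) → Set
  IsFair φ ρ = ∀ o i → ∃[ j ] i ℕ.≤ j × Fulfilled φ o (ρ j)

  holds-correct : ∀ φ {σ ρ} → IsRun φ σ ρ → IsFair φ ρ → ∀ i → Reflects (σ at i ⊨ φ) (holds φ (ρ i))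
  holds-correct tt          run fair i = ofʸ _
  holds-correct (atom a) {σ} run fair i rewrite run i = proof (σ i ≟ a)
  holds-correct (not φ)     run fair i = ¬-reflects (holds-correct φ run fair i)
  holds-correct (φ and ψ)   run fair i =
    holds-correct φ (proj₁ ∘ run) (fair ∘ inj₁) i ×-reflects holds-correct ψ (proj₂ ∘ run) (fair ∘ inj₂) i
  holds-correct (next φ)    run fair i rewrite run i .proj₁ = holds-correct φ (proj₂ ∘ run) fair (suc i)
  -- Both directions propagate the expansion law back from a later `j` to `i`: fairness provides `j`
  -- when the guess is positive, the semantic witness provides it when the formula holds.
  holds-correct (φ until ψ) {σ} {ρ} run fair i = fromEquivalence
    (λ Tb → let j , i≤j , f = fair (inj₁ _) i in sound (ℕ.≤⇒≤‴ i≤j) f (Equivalence.to T-≡ Tb))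
    (λ (j , i≤j , ψj , φ<j) → Equivalence.from T-≡ (complete (ℕ.≤⇒≤‴ i≤j) ψj φ<j))
    where
    β : ℕ → Bool
    β = proj₁ ∘ ρ

    φ-reflects : ∀ i → Reflects (σ at i ⊨ φ) (holds φ (ρ i .proj₂ .proj₁))
    φ-reflects = holds-correct φ (proj₁ ∘ proj₂ ∘ run) (fair ∘ inj₂ ∘ inj₁)

    ψ-reflects : ∀ i → Reflects (σ at i ⊨ ψ) (holds ψ (ρ i .proj₂ .proj₂))
    ψ-reflects = holds-correct ψ (proj₂ ∘ proj₂ ∘ run) (fair ∘ inj₂ ∘ inj₂)

    β-reflects : ∀ i → Reflects (σ at i ⊨ ψ ⊎ σ at i ⊨ φ × T (β (suc i))) (β i)
    β-reflects i rewrite run i .proj₁ = ψ-reflects i ⊎-reflects (φ-reflects i ×-reflects T-reflects _)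

    sound : ∀ {i j} → i ℕ.≤‴ j → (β j ≡ true → holds ψ (ρ j .proj₂ .proj₂) ≡ true) →
      β i ≡ true → σ at i ⊨ (φ until ψ)
    sound ℕ.≤‴-refl         f βi = until-fold {φ} {ψ} (inj₁ (reflects-from (ψ-reflects _) (f βi)))
    sound (ℕ.≤‴-step i<j) f βi with reflects-from (β-reflects _) βi
    ... | inj₁ ψi        = until-fold {φ} {ψ} (inj₁ ψi)
    ... | inj₂ (φi , βi+1) = until-fold {φ} {ψ} (inj₂ (φi , sound i<j f (Equivalence.to T-≡ βi+1)))

    complete : ∀ {i j} → i ℕ.≤‴ j → σ at j ⊨ ψ → (∀ m → i ℕ.≤ m → m ℕ.< j → σ at m ⊨ φ) → β i ≡ true
    complete ℕ.≤‴-refl         ψj φ<j = reflects-to (β-reflects _) (inj₁ ψj)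
    complete (ℕ.≤‴-step i<j) ψj φ<j = reflects-to (β-reflects _) (inj₂
      ( φ<j _ ℕ.≤-refl (ℕ.≤‴⇒≤ i<j)
      , Equivalence.from T-≡ (complete i<j ψj λ m i<m → φ<j m (ℕ.<⇒≤ i<m)) ))

  module _ (em₀ : ExcludedMiddle 0ℓ) where

    -- The run whose guesses are all true. Temporal truth along an arbitrary `σ` is not decidable,
    -- hence the appeal to `em₀`.
    label : ∀ φ → (ℕ → Fin k) → ℕ → St φ
    label tt          σ i = _
    label (atom a)    σ i = does (σ i ≟ a)
    label (not φ)     σ i = label φ σ i
    label (φ and ψ)   σ i = label φ σ i , label ψ σ i
    label (next φ)    σ i = does (em₀ {σ at suc i ⊨ φ}) , label φ σ i
    label (φ until ψ) σ i = does (em₀ {σ at i ⊨ (φ until ψ)}) , label φ σ i , label ψ σ i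

    holds-label : ∀ φ σ i → Reflects (σ at i ⊨ φ) (holds φ (label φ σ i))
    holds-label tt          σ i = ofʸ _
    holds-label (atom a)    σ i = proof (σ i ≟ a)
    holds-label (not φ)     σ i = ¬-reflects (holds-label φ σ i)
    holds-label (φ and ψ)   σ i = holds-label φ σ i ×-reflects holds-label ψ σ i
    holds-label (next φ)    σ i = proof em₀
    holds-label (φ until ψ) σ i = proof em₀

    label-isRun : ∀ φ σ → IsRun φ σ (label φ σ)
    label-isRun tt          σ i = _
    label-isRun (atom a)    σ i = refl
    label-isRun (not φ)     σ i = label-isRun φ σ i
    label-isRun (φ and ψ)   σ i = label-isRun φ σ i , label-isRun ψ σ i
    label-isRun (next φ)    σ i = det (proof em₀) (holds-label φ σ (suc i)) , label-isRun φ σ i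
    label-isRun (φ until ψ) σ i =
      det (proof em₀) (Reflects-map (until-fold {φ} {ψ}) (until-unfold {φ} {ψ})
        (holds-label ψ σ i ⊎-reflects (holds-label φ σ i ×-reflects proof em₀))) ,
      label-isRun φ σ i , label-isRun ψ σ i

    label-isFair : ∀ φ σ → IsFair φ (label φ σ)
    label-isFair (not φ)     σ o               i = label-isFair φ σ o i
    label-isFair (φ and ψ)   σ (inj₁ o)        i = label-isFair φ σ o i
    label-isFair (φ and ψ)   σ (inj₂ o)        i = label-isFair ψ σ o i
    label-isFair (next φ)    σ o               i = label-isFair φ σ o i
    label-isFair (φ until ψ) σ (inj₁ _)        i with em₀ {σ at i ⊨ (φ until ψ)} in eq
    ... | yes (j , i≤j , ψj , _) = j , i≤j , λ _ → reflects-to (holds-label ψ σ j) ψj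
    -- Where the `until` fails, the guess is negative and the obligation is fulfilled on the spot.
    ... | no ¬u = i , ℕ.≤-refl , λ βi → contradiction (trans (sym (cong does eq)) βi) λ ()
    label-isFair (φ until ψ) σ (inj₂ (inj₁ o)) i = label-isFair φ σ o i
    label-isFair (φ until ψ) σ (inj₂ (inj₂ o)) i = label-isFair ψ σ o i

  bools : List Bool
  bools = true ∷ false ∷ []

  ∈-bools : ∀ b → b ∈ˡ bools
  ∈-bools true  = here refl
  ∈-bools false = there (here refl)

  states : ∀ φ → List (St φ)
  states tt          = [ _ ]
  states (atom a)    = bools
  states (not φ)     = states φ
  states (φ and ψ)   = cartesianProduct (states φ) (states ψ)
  states (next φ)    = cartesianProduct bools (states φ)
  states (φ until ψ) = cartesianProduct bools (cartesianProduct (states φ) (states ψ))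

  ∈-states : ∀ φ s → s ∈ˡ states φ
  ∈-states tt          _           = here refl
  ∈-states (atom a)    b           = ∈-bools b
  ∈-states (not φ)     s           = ∈-states φ s
  ∈-states (φ and ψ)   (s , t)     = ∈-cartesianProduct⁺ (∈-states φ s) (∈-states ψ t)
  ∈-states (next φ)    (b , s)     = ∈-cartesianProduct⁺ (∈-bools b) (∈-states φ s)
  ∈-states (φ until ψ) (b , s , t) =
    ∈-cartesianProduct⁺ (∈-bools b) (∈-cartesianProduct⁺ (∈-states φ s) (∈-states ψ t))

  obligations : ∀ φ → List (Obligation φ)
  obligations tt          = []
  obligations (atom a)    = []
  obligations (not φ)     = obligations φ
  obligations (φ and ψ)   = map inj₁ (obligations φ) ++ map inj₂ (obligations ψ)
  obligations (next φ)    = obligations φ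
  obligations (φ until ψ) = inj₁ _ ∷ map inj₂ (map inj₁ (obligations φ) ++ map inj₂ (obligations ψ))

  ∈-obligations : ∀ φ o → o ∈ˡ obligations φ
  ∈-obligations (not φ)     o        = ∈-obligations φ o
  ∈-obligations (φ and ψ)   (inj₁ o) = ∈-++⁺ˡ (∈-map⁺ inj₁ (∈-obligations φ o))
  ∈-obligations (φ and ψ)   (inj₂ o) = ∈-++⁺ʳ (map inj₁ (obligations φ)) (∈-map⁺ inj₂ (∈-obligations ψ o))
  ∈-obligations (next φ)    o        = ∈-obligations φ o
  ∈-obligations (φ until ψ) (inj₁ _) = here refl
  -- The nested obligations, and their list, are exactly those of `φ and ψ`.
  ∈-obligations (φ until ψ) (inj₂ o) = there (∈-map⁺ inj₂ (∈-obligations (φ and ψ) o))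

  violations : LTL k → Automaton k
  violations φ = record
    { size       = length (states φ)
    ; conditions = length (obligations φ)
    ; Initial    = λ q → holds φ (lookup (states φ) q) ≡ false
    ; initial?   = λ q → holds φ (lookup (states φ) q) Bool.≟ false
    ; Step       = λ q c r → Succ φ (lookup (states φ) q) c (lookup (states φ) r)
    ; step?      = λ q c r → succ? φ (lookup (states φ) q) c (lookup (states φ) r)
    ; marks      = λ q → Vec.tabulate λ o → ⌊ fulfilled? φ (lookup (obligations φ) o) (lookup (states φ) q) ⌋
    }

  violations-sound : ∀ φ {σ} → Automaton.Accepts (violations φ) σ → ¬ (σ ⊨ φ)
  violations-sound φ (qs , init , run , fair) σ⊨φ =
    contradiction (trans (sym init) (reflects-to (holds-correct φ run fair′ 0) σ⊨φ)) λ ()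
    where
    fair′ : IsFair φ (lookup (states φ) ∘ qs)
    fair′ o i with j , i≤j , f ← fair (index (∈-obligations φ o)) i = j , i≤j ,
      subst (λ o → Fulfilled φ o _) (sym (lookup-index (∈-obligations φ o)))
        (∈-tabulate⁻ (λ o → fulfilled? φ (lookup (obligations φ) o) (lookup (states φ) (qs j))) f)

  violations-complete : ExcludedMiddle 0ℓ → ∀ φ {σ} → ¬ (σ ⊨ φ) → Automaton.Accepts (violations φ) σ
  violations-complete em₀ φ {σ} σ⊭φ = code ∘ ρ
    , trans (cong (holds φ) (decode-code (ρ 0))) (det (holds-label em₀ φ σ 0) (ofⁿ σ⊭φ))
    , run
    , λ c i → let j , i≤j , f = label-isFair em₀ φ σ (lookup (obligations φ) c) i in j , i≤j ,
        ∈-tabulate⁺ (λ o → fulfilled? φ (lookup (obligations φ) o) (lookup (states φ) (code (ρ j))))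
          (subst (Fulfilled φ (lookup (obligations φ) c)) (sym (decode-code (ρ j))) f)
    where
    ρ = label em₀ φ σ
    code : St φ → Fin (length (states φ))
    code s = index (∈-states φ s)
    decode-code : ∀ s → lookup (states φ) (code s) ≡ s
    decode-code s = sym (lookup-index (∈-states φ s))
    run : ∀ i → Succ φ (lookup (states φ) (code (ρ i))) (σ i) (lookup (states φ) (code (ρ (suc i))))
    run i rewrite decode-code (ρ i) | decode-code (ρ (suc i)) = label-isRun em₀ φ σ i

-- Ideals

module Paths {c s o} (S : TransitionSystem c s o) where
  open TransitionSystem S

  infixr 5 _++*_
  _++*_ : ∀ {x y z w w′} → x ⟶*[ w ] y → y ⟶*[ w′ ] z → x ⟶*[ w ++ w′ ] z
  []      ++* q = q
  (e ∷ p) ++* q = e ∷ (p ++* q)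

  take-path : ∀ (xs : ℕ → State) σ → (∀ i → xs i ⟶[ σ i ] xs (suc i)) → ∀ n → xs 0 ⟶*[ slice σ n ] xs n
  take-path xs σ es zero    = []
  take-path xs σ es (suc n) = es 0 ∷ take-path (xs ∘ suc) (σ ∘ suc) (es ∘ suc) n

  power-path : ∀ (xs : ℕ → State) {w} → (∀ i → xs i ⟶*[ w ] xs (suc i)) → ∀ n → xs 0 ⟶*[ concat (replicate n w) ] xs n
  power-path xs ps zero    = []
  power-path xs ps (suc n) = ps 0 ++* power-path (xs ∘ suc) (ps ∘ suc) n

  monotone* : StronglyMonotone → ∀ {x y x′ w} → x ⟶*[ w ] y → x ≤ x′ → ∃[ y′ ] x′ ⟶*[ w ] y′ × y ≤ y′
  monotone* mono []      x≤x′ = _ , [] , x≤x′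
  monotone* mono (e ∷ p) x≤x′ =
    let _ , e′ , u≤u′ = mono e x≤x′
        _ , p′ , y≤y′ = monotone* mono p u≤u′
    in _ , e′ ∷ p′ , y≤y′

  strictlyMonotone* : StrongStrictlyMonotone → ∀ {x y x′ w} → x ⟶*[ w ] y → x < x′ → ∃[ y′ ] x′ ⟶*[ w ] y′ × y < y′
  strictlyMonotone* mono []      x<x′ = _ , [] , x<x′
  strictlyMonotone* mono (e ∷ p) x<x′ =
    let _ , e′ , u<u′ = mono .proj₂ e x<x′
        _ , p′ , y<y′ = strictlyMonotone* mono p u<u′
    in _ , e′ ∷ p′ , y<y′

module Ideals (em : ExcludedMiddle (lsuc 0ℓ)) (S : TransitionSystem 0ℓ 0ℓ 0ℓ) (veryWSTS : Completion.IsVeryWSTS S) where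
  open Classical em public
  open TransitionSystem S public
  open Completion S public
  open Ideal public
  open IsIdeal public
  open IsVeryWSTS veryWSTS public
  open Paths S public
  module Ŝ = TransitionSystem completion
  module Pathsᶜ = Paths completion

  ≤-refl : ∀ {x} → x ≤ x
  ≤-refl = IsPreorder.refl isPreorder

  ≤-trans : ∀ {x y z} → x ≤ y → y ≤ z → x ≤ z
  ≤-trans = IsPreorder.trans isPreorder

  down : ∀ (I : Ideal) {x y} → x ≤ y → y ∈ carrier I → x ∈ carrier I
  down I = isIdeal I .downwardClosed

  ⊆-stable : ∀ {I J} → ¬ ¬ (I ⊆ᴵ J) → I ⊆ᴵ J
  ⊆-stable ¬¬I⊆J x∈I = decidable-stable em₀ λ x∉J → ¬¬I⊆J λ I⊆J → x∉J (I⊆J x∈I)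

  ↓ᴵ : State → Ideal
  ↓ᴵ x = record
    { carrier = _≤ x
    ; isIdeal = record
      { nonempty       = x , ≤-refl
      ; downwardClosed = ≤-trans
      ; directed       = λ y≤x z≤x → x , ≤-refl , y≤x , z≤x
      }
    }

  ascending : ∀ {Js : ℕ → Ideal} → (∀ k → Js k ⊆ᴵ Js (suc k)) → ∀ {k m} → k ℕ.≤ m → Js k ⊆ᴵ Js m
  ascending {Js} asc k≤m = go (ℕ.≤⇒≤′ k≤m)
    where
    go : ∀ {k m} → k ℕ.≤′ m → Js k ⊆ᴵ Js m
    go ℕ.≤′-refl       = id
    go (ℕ.≤′-step k≤m) = asc _ ∘ go k≤m

  ⋃ : (Js : ℕ → Ideal) → (∀ k → Js k ⊆ᴵ Js (suc k)) → Ideal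
  ⋃ Js asc = record
    { carrier = λ x → ∃[ k ] x ∈ carrier (Js k)
    ; isIdeal = record
      { nonempty       = let x , x∈ = isIdeal (Js 0) .nonempty in x , 0 , x∈
      ; downwardClosed = λ { x≤y (k , y∈) → k , down (Js k) x≤y y∈ }
      ; directed       = λ { (k , x∈) (m , y∈) →
          let z , z∈ , x≤z , y≤z = isIdeal (Js (k ℕ.⊔ m)) .directed
                (ascending {Js} asc (ℕ.m≤m⊔n k m) x∈) (ascending {Js} asc (ℕ.m≤n⊔m k m) y∈)
          in z , (k ℕ.⊔ m , z∈) , x≤z , y≤z }
      }
    }

  -- If nothing above I were maximal, unions of increasing sequences would
  -- produce ideals of every level.
  maximalIdeal : (D : Pred State 0ℓ) (I : Ideal) → carrier I ⊆ D →
    ∃[ M ] carrier M ⊆ D × I ⊆ᴵ M × (∀ K → carrier K ⊆ D → M ⊆ᴵ K → K ⊆ᴵ M)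
  maximalIdeal D I I⊆D = decidable-stable em λ ¬∃ →
    let open NoMaximal ¬∃
        n , empty = finitelyManyLevels
        (K , _) , K∈ , _ = climb n (I , I⊆D , id)
    in empty K K∈
    where
    module NoMaximal (¬∃ : ¬ (∃[ M ] carrier M ⊆ D × I ⊆ᴵ M × (∀ K → carrier K ⊆ D → M ⊆ᴵ K → K ⊆ᴵ M))) where
      Above : Set₁
      Above = Σ[ K ∈ Ideal ] carrier K ⊆ D × I ⊆ᴵ K

      extend : (K : Above) → Σ[ L ∈ Above ] proj₁ K ⊂ᴵ proj₁ L
      extend (K , K⊆D , I⊆K) with em {Σ[ L ∈ Above ] K ⊂ᴵ proj₁ L}
      ... | yes L = L
      ... | no ¬L = ⊥-elim (¬∃ (K , K⊆D , I⊆K , max))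
        where
        max : ∀ L → carrier L ⊆ D → K ⊆ᴵ L → L ⊆ᴵ K
        max L L⊆D K⊆L = ⊆-stable {L} {K} λ L⊈K → ¬L ((L , L⊆D , λ x∈ → K⊆L (I⊆K x∈)) , K⊆L , L⊈K)

      -- Alternating a strict extension with a climb to level `n` gives a strictly increasing
      -- sequence of level `n`; its union has level `suc n`.
      climb : ∀ n (K : Above) → Σ[ L ∈ Above ] proj₁ L ∈ Idl n × proj₁ K ⊆ᴵ proj₁ L
      climb zero    K = K , _ , id
      climb (suc n) K =
        ( ⋃ (proj₁ ∘ Ls) (λ k → inc k .proj₁)
        , (λ { (k , x∈) → Ls k .proj₂ .proj₁ x∈ })
        , λ x∈I → 0 , Ls 0 .proj₂ .proj₂ x∈I )
        , (proj₁ ∘ Ls , Ls∈ , inc , id , id)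
        , λ x∈K → 0 , climb n K .proj₂ .proj₂ x∈K
        where
        Ls : ℕ → Above
        Ls zero    = climb n K .proj₁
        Ls (suc k) = climb n (extend (Ls k) .proj₁) .proj₁

        Ls∈ : ∀ k → proj₁ (Ls k) ∈ Idl n
        Ls∈ zero    = climb n K .proj₂ .proj₁
        Ls∈ (suc k) = climb n (extend (Ls k) .proj₁) .proj₂ .proj₁

        inc : ∀ k → proj₁ (Ls k) ⊂ᴵ proj₁ (Ls (suc k))
        inc k with L , (L⊆ , ⊈L) ← extend (Ls k) =
          (λ x∈ → climb n L .proj₂ .proj₂ (L⊆ x∈)) ,
          λ ⊆L → ⊈L (λ x∈ → ⊆L (climb n L .proj₂ .proj₂ x∈))

  post : Ideal → Letter → Pred State 0ℓ
  post I a = ↓ (Post (carrier I) a)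

  post-mono : ∀ {I J a} → I ⊆ᴵ J → post I a ⊆ post J a
  post-mono I⊆J (y , (x , x∈ , e) , z≤y) = y , (x , I⊆J x∈ , e) , z≤y

  -- Directedness comes from determinism. Each element lies in a maximal ideal within `post I a`;
  -- these ideals are completion successors of `I`, hence all equal, so two elements have a common
  -- bound in one of them.
  postᴵ : ∀ I a → ∃[ x ] x ∈ post I a → Ideal
  postᴵ I a nonempty = record
    { carrier = post I a
    ; isIdeal = record
      { nonempty       = nonempty
      ; downwardClosed = λ { x≤y (z , z∈ , y≤z) → z , z∈ , ≤-trans x≤y y≤z }
      ; directed       = directed′
      }
    }
    where
    maximalAbove : ∀ {x} → x ∈ post I a → ∃[ M ] I ⇒[ a ] M × x ∈ carrier M
    maximalAbove {x} (z , z∈ , x≤z) =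
      let M , M⊆ , x∈M , max = maximalIdeal (post I a) (↓ᴵ x) (λ y≤x → z , z∈ , ≤-trans y≤x x≤z)
      in M , (M⊆ , max) , x∈M ≤-refl

    directed′ : ∀ {x y} → x ∈ post I a → y ∈ post I a → ∃[ z ] z ∈ post I a × x ≤ z × y ≤ z
    directed′ x∈ y∈ =
      let M , I⇒M , x∈M = maximalAbove x∈
          N , I⇒N , y∈N = maximalAbove y∈
          z , z∈M , x≤z , y≤z = isIdeal M .directed x∈M (completionDeterministic {I} {N} {M} I⇒N I⇒M .proj₁ y∈N)
      in z , I⇒M .proj₁ z∈M , x≤z , y≤z

  post⇒ : ∀ {I a J} → carrier J ≐ post I a → I ⇒[ a ] J
  post⇒ (J⊆ , ⊆J) = J⊆ , λ K K⊆ _ → ⊆J ∘ K⊆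

  -- Since `post I a` is itself an ideal, a maximal ideal inside it is all of it.
  ⇒post : ∀ {I a J} → I ⇒[ a ] J → carrier J ≐ post I a
  ⇒post {I} {a} {J} (J⊆ , max) =
    let x , x∈ = isIdeal J .nonempty
    in J⊆ , max (postᴵ I a (x , J⊆ x∈)) id J⊆

  successor : ∀ I {a x y} → x ∈ carrier I → x ⟶[ a ] y → ∃[ J ] I ⇒[ a ] J × y ∈ carrier J
  successor I {a} {x} {y} x∈ e = J , post⇒ {I} {a} {J} (id , id) , y∈
    where
    y∈ = y , (x , x∈ , e) , ≤-refl
    J = postᴵ I a (y , y∈)

  ⇒-mono : ∀ {I J a I′ J′} → I ⊆ᴵ J → I ⇒[ a ] I′ → J ⇒[ a ] J′ → I′ ⊆ᴵ J′
  ⇒-mono {I} {J} {a} {I′} {J′} I⊆J I⇒ J⇒ x∈ =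
    ⇒post {J} {a} {J′} J⇒ .proj₂ (post-mono {I} {J} I⊆J (⇒post {I} {a} {I′} I⇒ .proj₁ x∈))

  ⇒*-mono : ∀ {I J w I′ J′} → I ⊆ᴵ J → I ⇒*[ w ] I′ → J ⇒*[ w ] J′ → I′ ⊆ᴵ J′
  ⇒*-mono I⊆J Ŝ.[]       Ŝ.[]       = I⊆J
  ⇒*-mono I⊆J (Ŝ._∷_ {x = I} {y = I′} e p) (Ŝ._∷_ {x = J} {y = J′} f q) =
    ⇒*-mono (⇒-mono {I} {J} {_} {I′} {J′} I⊆J e f) p q

  -- Each step is matched only up to a larger state, from which strong monotonicity replays the rest
  -- of the word.
  ⇒*-preimage : ∀ {I w J y} → I ⇒*[ w ] J → y ∈ carrier J → ∃₂ λ x y′ → x ∈ carrier I × x ⟶*[ w ] y′ × y ≤ y′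
  ⇒*-preimage Ŝ.[]      y∈ = _ , _ , y∈ , [] , ≤-refl
  ⇒*-preimage (e Ŝ.∷ p) y∈ =
    let u , y′ , u∈ , q , y≤y′ = ⇒*-preimage p y∈
        v , (x , x∈ , f) , u≤v = e .proj₁ u∈
        y″ , q′ , y′≤y″ = monotone* stronglyMonotone q u≤v
    in x , y″ , x∈ , f ∷ q′ , ≤-trans y≤y′ y′≤y″

  ⇒*-image : ∀ {I w J x y} → I ⇒*[ w ] J → x ∈ carrier I → x ⟶*[ w ] y → y ∈ carrier J
  ⇒*-image Ŝ.[]       x∈ []      = x∈
  ⇒*-image (Ŝ._∷_ {x = I} {y = I′} {a = a} e p) x∈ (f ∷ q) =
    ⇒*-image p (⇒post {I} {a} {I′} e .proj₂ (_ , (_ , x∈ , f) , ≤-refl)) q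

  -- Strict monotonicity promises only some successor `K` of `J`; by `⇒*-mono` it is included in the
  -- given `J′`.
  ⇒*-strict : ∀ {I J w I′ J′} → I ⊂ᴵ J → I ⇒*[ w ] I′ → J ⇒*[ w ] J′ → I′ ⊂ᴵ J′
  ⇒*-strict {J = J} {I′ = I′} {J′ = J′} I⊂J p q =
    let K , q′ , I′⊆K , K⊈I′ = Pathsᶜ.strictlyMonotone* completionStrongStrictlyMonotone p I⊂J
    in (λ {x} x∈ → ⇒*-mono {J} {J} id q′ q (I′⊆K x∈)) ,
       λ J′⊆I′ → K⊈I′ (λ x∈ → J′⊆I′ (⇒*-mono {J} {J} id q′ q x∈))

  -- Taking `post` commutes with increasing unions, and strict monotonicity keeps the sequence
  -- strict. It starts at an index `k` from which `a` is enabled.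
  Idl-⇒ : ∀ n {I a J} → I ∈ Idl n → I ⇒[ a ] J → J ∈ Idl n
  Idl-⇒ zero    _ _ = _
  Idl-⇒ (suc n) {I} {a} {J} (Is , Is∈ , inc , I⊆ , ⊆I) I⇒J
    with z , z∈ ← isIdeal J .nonempty
    with y , (x , x∈ , e) , z≤y ← I⇒J .proj₁ z∈
    with k , x∈k ← I⊆ x∈
    = Js , (λ m → Idl-⇒ n (Is∈ (m + k)) (Is⇒Js m))
    , (λ m → ⇒*-strict {Is (m + k)} {Is (suc m + k)} (inc (m + k)) (Is⇒Js* m) (Is⇒Js* (suc m)))
    , J⊆ , λ { (m , x∈) → ⇒-mono {Is (m + k)} {I} {a} {Js m} {J} (λ y∈ → ⊆I (m + k , y∈)) (Is⇒Js m) I⇒J x∈ }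
    where
    asc : ∀ {i j} → i ℕ.≤ j → Is i ⊆ᴵ Is j
    asc = ascending {Is} (λ i → inc i .proj₁)

    succs : ∀ m → ∃[ K ] Is (m + k) ⇒[ a ] K × y ∈ carrier K
    succs m = successor (Is (m + k)) (asc (ℕ.m≤n+m k m) x∈k) e

    Js : ℕ → Ideal
    Js m = succs m .proj₁

    Is⇒Js : ∀ m → Is (m + k) ⇒[ a ] Js m
    Is⇒Js m = succs m .proj₂ .proj₁

    Is⇒Js* : ∀ m → Is (m + k) ⇒*[ [ a ] ] Js m
    Is⇒Js* m = Is⇒Js m Ŝ.∷ Ŝ.[]

    J⊆ : carrier J ⊆ (λ x → ∃[ m ] x ∈ carrier (Js m))
    J⊆ z∈ with y , (x , x∈ , e) , z≤y ← I⇒J .proj₁ z∈ with m , x∈m ← I⊆ x∈ =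
      m , ⇒post {Is (m + k)} {a} {Js m} (Is⇒Js m) .proj₂ (y , (x , asc (ℕ.m≤m+n m k) x∈m , e) , z≤y)

  module Acceleration {w I J} (I⇒J : I ⇒*[ w ] J) (I⊂J : I ⊂ᴵ J) where
    private
      Growing : Set₁
      Growing = Σ[ K ∈ Ideal ] Grows w K

      grow : Growing → Growing
      grow (K , L , K⇒L , K⊂L) =
        let M , L⇒M , L⊂M = Pathsᶜ.strictlyMonotone* completionStrongStrictlyMonotone K⇒L K⊂L
        in L , M , L⇒M , L⊂M

      growing : ℕ → Growing
      growing zero    = I , J , I⇒J , I⊂J
      growing (suc k) = grow (growing k)

      powers : ℕ → Ideal
      powers = proj₁ ∘ growing

      powers-inc : ∀ k → powers k ⊂ᴵ powers (suc k)
      powers-inc k = growing k .proj₂ .proj₂ .proj₂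

      powers-path : ∀ k → I ⇒*[ concat (replicate k w) ] powers k
      powers-path = Pathsᶜ.power-path powers (λ k → growing k .proj₂ .proj₂ .proj₁)

    limit : Ideal
    limit = ⋃ powers (λ k → powers-inc k .proj₁)

    limit-^∞ : carrier limit ≐ w ^∞ I
    limit-^∞ =
      (λ { (k , x∈) → inj₁ ((J , I⇒J , I⊂J) , k , powers k , powers-path k , x∈) }) ,
      λ { (inj₁ (_ , k , K , I⇒K , x∈)) → k , ⇒*-mono {I} {I} id I⇒K (powers-path k) x∈
        ; (inj₂ (¬grows , _)) → contradiction (J , I⇒J , I⊂J) ¬grows }

    ⊆-limit : J ⊆ᴵ limit
    ⊆-limit x∈ = 1 , x∈

    -- Acceleration gains a level: the powers keep the level of `I`, and the limit is their strictly
    -- increasing union.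
    limit-Idl : ∀ {n} → I ∈ Idl n → limit ∈ Idl (suc n)
    limit-Idl {n} I∈ = powers , powers∈ , powers-inc , id , id
      where
      Idl-⇒* : ∀ {K v L} → K ∈ Idl n → K ⇒*[ v ] L → L ∈ Idl n
      Idl-⇒* K∈ Ŝ.[]      = K∈
      Idl-⇒* K∈ (e Ŝ.∷ p) = Idl-⇒* (Idl-⇒ n K∈ e) p

      powers∈ : ∀ k → powers k ∈ Idl n
      powers∈ k = Idl-⇒* I∈ (powers-path k)

-- Finite exploration of the product with an automaton.

module ProductSystem (em : ExcludedMiddle (lsuc 0ℓ)) (S : TransitionSystem 0ℓ 0ℓ 0ℓ) (veryWSTS : Completion.IsVeryWSTS S)
  (A : Automaton (TransitionSystem.∣Σ∣ S)) (x₀ : TransitionSystem.State S) where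

  open Ideals em S veryWSTS
  open Automaton A

  Config : Set
  Config = Fin size × State

  Edge : Config → Letter → Config → Set
  Edge (q , x) a (r , y) = Step q a r × x ⟶[ a ] y

  module Runs = Walks Step
  module Joint = Walks Edge
  open Runs using () renaming (Walk to Run; _++ʷ_ to _++ʳ_)

  joint : ∀ {q w r x y} → Run q w r → x ⟶*[ w ] y → Joint.Walk (q , x) w (r , y)
  joint []      []      = []
  joint (e ∷ p) (f ∷ q) = (e , f) ∷ joint p q

  Covered : Fin size → State → Set
  Covered q x = ∃₂ λ q₀ w → ∃[ y ] Initial q₀ × Joint.Walk (q₀ , x₀) w (q , y) × x ≤ y

  covered-down : ∀ {q x y} → x ≤ y → Covered q y → Covered q x
  covered-down x≤y (q₀ , w , z , init , p , y≤z) = q₀ , w , z , init , p , ≤-trans x≤y y≤z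

  covered-extend : ∀ {q x w r y} → Run q w r → x ⟶*[ w ] y → Covered q x → Covered r y
  covered-extend ρ p (q₀ , w , z , init , u , x≤z) =
    let y′ , p′ , y≤y′ = monotone* stronglyMonotone p x≤z
    in q₀ , _ , y′ , init , u Joint.++ʷ joint ρ p′ , y≤y′

  -- Bounding the length of accelerated words makes every stage finite.
  data Reach : ℕ → Fin size → Ideal → Set₁ where
    root  : ∀ {q I} → Initial q → carrier I ≐ (_≤ x₀) → Reach 0 q I
    keep  : ∀ {k q I} → Reach k q I → Reach (suc k) q I
    step  : ∀ {k q I a r J} → Reach k q I → Step q a r → I ⇒[ a ] J → Reach (suc k) r J
    accel : ∀ {k q I w J} → Reach k q I → length w ℕ.≤ k → Run q w q → carrier J ≐ w ^∞ I → Reach (suc k) q J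

  reach-mono : ∀ {k m q I} → k ℕ.≤ m → Reach k q I → Reach m q I
  reach-mono k≤m = go (ℕ.≤⇒≤′ k≤m)
    where
    go : ∀ {k m q I} → k ℕ.≤′ m → Reach k q I → Reach m q I
    go ℕ.≤′-refl     n = n
    go (ℕ.≤′-step p) n = keep (go p n)

  -- Accelerated words must loop on `q`: an element of the `k`-th power of `w` is then covered by a
  -- path that repeats the run `k` times and returns to the same automaton state.
  reach-sound : ∀ {k q I x} → Reach k q I → x ∈ carrier I → Covered q x
  reach-sound (root init I≐) x∈ = _ , [] , x₀ , init , [] , I≐ .proj₁ x∈
  reach-sound (keep n)       x∈ = reach-sound n x∈
  reach-sound (step n s I⇒J) x∈ with y , (x′ , x′∈ , e) , x≤y ← I⇒J .proj₁ x∈ =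
    covered-down x≤y (covered-extend (s ∷ []) (e ∷ []) (reach-sound n x′∈))
  reach-sound (accel n _ ρ J≐) x∈ with J≐ .proj₁ x∈
  ... | inj₂ (_ , x∈I) = reach-sound n x∈I
  ... | inj₁ (_ , k , K , I⇒K , x∈K) with x′ , y , x′∈ , p , x≤y ← ⇒*-preimage I⇒K x∈K =
    covered-down x≤y (covered-extend (Runs.replicateʷ ρ k) p (reach-sound n x′∈))

  Node : Set₁
  Node = Fin size × Ideal

  Reachable : Pred Node (lsuc 0ℓ)
  Reachable (q , I) = ∃[ k ] Reach k q I

  infix 4 _⊑_
  data _⊑_ : Rel Node (lsuc 0ℓ) where
    within : ∀ {q r I J} → q ≡ r → I ⊆ᴵ J → (q , I) ⊑ (r , J)

  data Successor : Node → Pred Node (lsuc 0ℓ) where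
    along : ∀ {q I a r J} → Step q a r → I ⇒[ a ] J → Successor (q , I) (r , J)

  record CoveredBy (L H : List Node) (n : Node) : Set₁ where
    constructor covered-by
    field
      {cover} : Node
      among   : cover ∈ˡ L ⊎ cover ∈ˡ H
      below   : n ⊑ cover

  covered-mono : ∀ {L H L′ H′ n} → (∀ {m} → m ∈ˡ L ⊎ m ∈ˡ H → m ∈ˡ L′ ⊎ m ∈ˡ H′) →
    CoveredBy L H n → CoveredBy L′ H′ n
  covered-mono ⊆L (covered-by m∈ n⊑m) = covered-by (⊆L m∈) n⊑m

  covered-⊑ : ∀ {L H n m} → n ⊑ m → CoveredBy L H m → CoveredBy L H n
  covered-⊑ (within refl I⊆J) (covered-by m∈ (within refl J⊆K)) =
    covered-by m∈ (within refl λ x∈ → J⊆K (I⊆J x∈))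

  -- H holds the ancestors of the part of the tree being explored.
  record Exploration (H : List Node) (Target : Pred Node (lsuc 0ℓ)) : Set₁ where
    field
      nodes     : List Node
      reachable : ∀ {n} → n ∈ˡ nodes → Reachable n
      covers    : ∀ {n} → n ∈ Target → CoveredBy nodes H n
      closed    : ∀ {n m} → n ∈ˡ nodes → Successor n m → CoveredBy nodes H m

  open Exploration

  Below : Node → Pred Node (lsuc 0ℓ)
  Below n m = m ⊑ n

  gather : ∀ {X : Set} {H} {T : X → Pred Node (lsuc 0ℓ)} → (∀ x → Exploration H (T x)) →
    ∀ xs → Exploration H (λ n → ∃[ x ] x ∈ˡ xs × n ∈ T x)
  gather f []       = record { nodes = [] ; reachable = λ () ; covers = λ () ; closed = λ () }
  gather {H = H} f (x ∷ xs) = record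
    { nodes     = nodes E ++ nodes F
    ; reachable = [ reachable E , reachable F ]′ ∘ ∈-++⁻ (nodes E)
    ; covers    = λ { (_ , here refl , n∈) → left (covers E n∈)
                    ; (y , there y∈ , n∈)  → right (covers F (y , y∈ , n∈)) }
    ; closed    = λ n∈ s → [ (λ n∈ → left (closed E n∈ s)) , (λ n∈ → right (closed F n∈ s)) ]′ (∈-++⁻ (nodes E) n∈)
    }
    where
    E = f x
    F = gather f xs
    left : ∀ {n} → CoveredBy (nodes E) H n → CoveredBy (nodes E ++ nodes F) H n
    left = covered-mono [ inj₁ ∘ ∈-++⁺ˡ , inj₂ ]′
    right : ∀ {n} → CoveredBy (nodes F) H n → CoveredBy (nodes E ++ nodes F) H n
    right = covered-mono [ inj₁ ∘ ∈-++⁺ʳ (nodes E) , inj₂ ]′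

  -- Below `n` a node may be covered by its ancestor `n`. Once `n` joins the explored nodes, that
  -- becomes coverage by a node.
  expand : ∀ {H n} → Reachable n → (∀ {m} → Successor n m → Exploration (n ∷ H) (Below m)) → Exploration H (Below n)
  expand {H} {n@(q , I)} reach explore = record
    { nodes     = n ∷ nodes E
    ; reachable = λ { (here refl) → reach ; (there m∈) → reachable E m∈ }
    ; covers    = covered-by (inj₁ (here refl))
    ; closed    = closed′
    }
    where
    Target : Letter × Fin size → Pred Node (lsuc 0ℓ)
    Target (a , r) (r′ , J) = r′ ≡ r × Step q a r′ × I ⇒[ a ] J

    -- By determinism one successor per letter and automaton state represents all of them, so
    -- branching is finite.
    child : ∀ ar → Exploration (n ∷ H) (Target ar)
    child (a , r) with em {∃[ J ] Step q a r × I ⇒[ a ] J}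
    ... | no ¬J = record
      { nodes     = []
      ; reachable = λ ()
      ; covers    = λ { {_ , J} (refl , s) → contradiction (J , s) ¬J }
      ; closed    = λ ()
      }
    ... | yes (J , s , I⇒J) = record
      { nodes     = nodes F
      ; reachable = reachable F
      ; covers    = λ { {_ , K} (refl , _ , I⇒K) → covers F (within refl (⇒-mono {I} {I} {a} {K} {J} id I⇒K I⇒J)) }
      ; closed    = closed F
      }
      where F = explore {r , J} (along s I⇒J)

    E = gather child (cartesianProduct (allFin ∣Σ∣) (allFin size))

    shift : ∀ {m} → CoveredBy (nodes E) (n ∷ H) m → CoveredBy (n ∷ nodes E) H m
    shift = covered-mono λ
      { (inj₁ m∈)          → inj₁ (there m∈)
      ; (inj₂ (here refl)) → inj₁ (here refl)
      ; (inj₂ (there m∈))  → inj₂ m∈ }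

    closed′ : ∀ {l m} → l ∈ˡ n ∷ nodes E → Successor l m → CoveredBy (n ∷ nodes E) H m
    closed′ {m = r , J} (here refl) (along {a = a} s I⇒J) =
      shift (covers E ((a , r) , ∈-cartesianProduct⁺ (∈-allFin a) (∈-allFin r) , refl , s , I⇒J))
    closed′ (there l∈) s = shift (closed E l∈ s)

  -- An infinite branch contains n_i ⊑ n_j with i < j; then n_j is covered
  -- either by n_i or by the acceleration of n_i, which has a greater level.
  module Descent (l : ℕ) (higher : ∀ {q I} → Reachable (q , I) → I ∈ Idl (suc l) → Exploration [] (Below (q , I))) where

    record Stuck : Set₁ where
      field
        ancestors  : List Node
        node       : Node
        reach      : Reachable node
        level      : node .proj₂ ∈ Idl l
        unexplored : ¬ Exploration ancestors (Below node)

    open Stuck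

    -- If all successors had explorations, `expand` would assemble them into one for the node
    -- itself.
    deeper : (s : Stuck) → Σ[ t ∈ Stuck ] ancestors t ≡ node s ∷ ancestors s × Successor (node s) (node t)
    deeper s with em {∃[ m ] Successor (node s) m × ¬ Exploration (node s ∷ ancestors s) (Below m)}
    ... | no ¬m = contradiction
      (expand (reach s) λ s⇒m → decidable-stable em λ ¬E → ¬m (_ , s⇒m , ¬E)) (unexplored s)
    ... | yes (m , s⇒m@(along st I⇒J) , ¬E) = record
      { ancestors  = node s ∷ ancestors s
      ; node       = m
      ; reach      = let k , R = reach s in suc k , step R st I⇒J
      ; level      = Idl-⇒ l (level s) I⇒J
      ; unexplored = ¬E
      } , refl , s⇒m

    module Branch (s₀ : Stuck) where
      stage : ℕ → Stuck
      stage zero    = s₀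
      stage (suc k) = deeper (stage k) .proj₁

      state : ℕ → Fin size
      state k = node (stage k) .proj₁

      idl : ℕ → Ideal
      idl k = node (stage k) .proj₂

      ancestor : ∀ {i j} → suc i ℕ.≤′ j → node (stage i) ∈ˡ ancestors (stage j)
      ancestor {i} ℕ.≤′-refl rewrite deeper (stage i) .proj₂ .proj₁ = here refl
      ancestor {j = suc j} (ℕ.≤′-step i<j) rewrite deeper (stage j) .proj₂ .proj₁ = there (ancestor i<j)

      path : ∀ {i j} → i ℕ.≤′ j → ∃[ w ] Run (state i) w (state j) × idl i ⇒*[ w ] idl j
      path ℕ.≤′-refl         = [] , [] , Ŝ.[]
      path (ℕ.≤′-step {j} i≤j) with w , ρ , p ← path i≤j | along {a = a} s e ← deeper (stage j) .proj₂ .proj₂ =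
        w ++ [ a ] , ρ ++ʳ (s ∷ []) , p Pathsᶜ.++* (e Ŝ.∷ Ŝ.[])

      impossible : ⊥
      impossible with i , j , i<j , qi≡qj , Ii⊆Ij ← wqo-pair {R = _⊆ᴵ_} (completionIsWSTS .proj₁) state idl
        with em₀ {idl j ⊆ᴵ idl i}
      -- The earlier node is an ancestor, so an exploration without nodes suffices.
      ... | yes Ij⊆Ii = unexplored (stage j) record
        { nodes     = []
        ; reachable = λ ()
        ; covers    = λ m⊑ → covered-⊑ m⊑ (covered-by (inj₂ (ancestor (ℕ.≤⇒≤′ i<j))) (within (sym qi≡qj) Ij⊆Ii))
        ; closed    = λ ()
        }
      ... | no Ij⊈Ii = unexplored (stage j) record
        { nodes     = nodes E
        ; reachable = reachable E
        ; covers    = λ m⊑ → covered-⊑ m⊑ (weaken-H (covers E (within (sym qi≡qj) ⊆-limit)))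
        ; closed    = λ n∈ s → weaken-H (closed E n∈ s)
        }
        where
        w = path (ℕ.≤⇒≤′ (ℕ.<⇒≤ i<j)) .proj₁
        ρ : Run (state i) w (state i)
        ρ = subst (Run (state i) w) (sym qi≡qj) (path (ℕ.≤⇒≤′ (ℕ.<⇒≤ i<j)) .proj₂ .proj₁)
        open Acceleration (path (ℕ.≤⇒≤′ (ℕ.<⇒≤ i<j)) .proj₂ .proj₂) (Ii⊆Ij , Ij⊈Ii)
        k = reach (stage i) .proj₁
        E = higher {state i} {limit}
          -- The maximum is a stage late enough for `w` to respect the length bound.
          (_ , accel (reach-mono (ℕ.m≤m⊔n k (length w)) (reach (stage i) .proj₂)) (ℕ.m≤n⊔m k (length w)) ρ limit-^∞)
          (limit-Idl (level (stage i)))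
        weaken-H : ∀ {n H} → CoveredBy (nodes E) [] n → CoveredBy (nodes E) H n
        weaken-H = covered-mono λ { (inj₁ m∈) → inj₁ m∈ }

    explore : ∀ {q I} → Reachable (q , I) → I ∈ Idl l → Exploration [] (Below (q , I))
    explore reach I∈ = decidable-stable em λ ¬E → Branch.impossible record
      { ancestors = [] ; node = _ ; reach = reach ; level = I∈ ; unexplored = ¬E }

  -- Induction on levels downwards, from one without ideals, where there is nothing to explore, to
  -- level 0, which contains every ideal.
  explore : ∀ {q I} → Reachable (q , I) → Exploration [] (Below (q , I))
  explore reach = descend (finitelyManyLevels .proj₁) (λ _ I∈ → ⊥-elim (finitelyManyLevels .proj₂ _ I∈)) reach _
    where
    descend : ∀ l → (∀ {q I} → Reachable (q , I) → I ∈ Idl l → Exploration [] (Below (q , I))) →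
      ∀ {q I} → Reachable (q , I) → I ∈ Idl 0 → Exploration [] (Below (q , I))
    descend zero    higher = higher
    descend (suc l) higher = descend l (Descent.explore l higher)

  exploration : Exploration [] (λ n → ∃[ q ] q ∈ˡ allFin size × Initial q × n ≡ (q , ↓ᴵ x₀))
  exploration = gather fromState (allFin size)
    where
    fromState : ∀ q → Exploration [] (λ n → Initial q × n ≡ (q , ↓ᴵ x₀))
    fromState q with initial? q
    ... | no ¬init = record
      { nodes = [] ; reachable = λ () ; covers = λ (init , _) → contradiction init ¬init ; closed = λ () }
    ... | yes init = record
      { nodes     = nodes E
      ; reachable = reachable E
      ; covers    = λ { (_ , refl) → covers E (within refl id) }
      ; closed    = closed E
      }
      where E = explore {q} {↓ᴵ x₀} (0 , root init (id , id))

  exploration-bound : ∃[ K ] (∀ {q I} → (q , I) ∈ˡ nodes exploration → Reach K q I)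
  exploration-bound = bound (nodes exploration) (reachable exploration)
    where
    bound : ∀ L → (∀ {n} → n ∈ˡ L → Reachable n) → ∃[ K ] (∀ {q I} → (q , I) ∈ˡ L → Reach K q I)
    bound []      _     = 0 , λ ()
    bound (n ∷ L) reach =
      let k , R = reach (here refl)
          m , Rs = bound L (reach ∘ there)
      in k ℕ.⊔ m , λ { (here refl) → reach-mono (ℕ.m≤m⊔n k m) R ; (there n∈) → reach-mono (ℕ.m≤n⊔m k m) (Rs n∈) }

  -- With no ancestors left, every successor is covered by a node, so a walk from `x₀` can be
  -- followed from node to node.
  exploration-∋ : ∀ {q x} → Covered q x → ∃[ I ] (q , I) ∈ˡ nodes exploration × x ∈ carrier I
  exploration-∋ (q₀ , w , y , init , p , x≤y) with covers exploration (q₀ , ∈-allFin q₀ , init , refl)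
  ... | covered-by (inj₁ n∈) (within refl ↓x₀⊆I) =
    let I , n∈′ , y∈ = follow p n∈ (↓x₀⊆I ≤-refl) in I , n∈′ , down I x≤y y∈
    where
    follow : ∀ {q x w r y I} → Joint.Walk (q , x) w (r , y) → (q , I) ∈ˡ nodes exploration → x ∈ carrier I →
      ∃[ J ] (r , J) ∈ˡ nodes exploration × y ∈ carrier J
    follow []            n∈ x∈ = _ , n∈ , x∈
    follow {I = I} ((s , e) ∷ p) n∈ x∈ with successor I x∈ e
    ... | J , I⇒J , y∈ with closed exploration {m = _ , J} n∈ (along s I⇒J)
    ...   | covered-by (inj₁ m∈) (within refl J⊆) = follow p m∈ (J⊆ y∈)

  -- If `J` fitted into no node at `q`, one of its elements would avoid them all, although it is
  -- covered.
  exploration-⊇ : ∀ {q J} → (∀ {x} → x ∈ carrier J → Covered q x) → ∃[ I ] (q , I) ∈ˡ nodes exploration × J ⊆ᴵ I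
  exploration-⊇ {q} {J} covered with em {∃[ I ] (q , I) ∈ˡ nodes exploration × J ⊆ᴵ I}
  ... | yes I = I
  ... | no ¬I =
    let z , z∈ , z∉ = escape (nodes exploration) (λ {I} n∈ J⊆I → ¬I (I , n∈ , J⊆I))
        I , n∈ , z∈I = exploration-∋ (covered z∈)
    in contradiction z∈I (z∉ n∈)
    where
    -- By directedness one element of J escapes all the ideals not including J.
    escape : ∀ L → (∀ {I} → (q , I) ∈ˡ L → ¬ (J ⊆ᴵ I)) →
      ∃[ z ] z ∈ carrier J × (∀ {I} → (q , I) ∈ˡ L → ¬ (z ∈ carrier I))
    escape []            J⊈ = let z , z∈ = isIdeal J .nonempty in z , z∈ , λ ()
    escape ((r , I) ∷ L) J⊈ with escape L (J⊈ ∘ there) | r ≟ q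
    ... | z , z∈ , z∉ | no r≢q   = z , z∈ , λ { (here refl) → contradiction refl r≢q ; (there n∈) → z∉ n∈ }
    ... | z , z∈ , z∉ | yes refl with em₀ {∃[ x ] x ∈ carrier J × ¬ (x ∈ carrier I)}
    ...   | no ¬x = ⊥-elim (J⊈ (here refl) λ {x} x∈ → decidable-stable em₀ λ x∉ → ¬x (x , x∈ , x∉))
    ...   | yes (x , x∈ , x∉) =
      let y , y∈ , x≤y , z≤y = isIdeal J .directed x∈ z∈
      in y , y∈ , λ
        { (here refl) y∈I    → x∉ (down I x≤y y∈I)
        ; {K} (there n∈) y∈K → z∉ n∈ (down K z≤y y∈K) }

  Counterexample : Set
  Counterexample = Σ[ σ ∈ (ℕ → Letter) ] IsInfiniteTrace x₀ σ × Accepts σ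

  -- Closed families of nodes and their positive fair cycles.

  module Family {r : ℕ} (qs : Fin r → Fin size) (Is : Fin r → Ideal) where

    ExactEdge : Fin r → Letter → Fin r → Set₁
    ExactEdge u a v = Step (qs u) a (qs v) × Is u ⇒[ a ] Is v

    module Exact = Walks ExactEdge

    Disabled : Fin r → Letter → Set₁
    Disabled u a = ∀ J → ¬ (Is u ⇒[ a ] J)

    Includes : Fin r → Letter → Fin r → Set₁
    Includes u a v = ∀ J → Is u ⇒[ a ] J → J ⊆ᴵ Is v

    Closed : Set₁
    Closed = ∀ u a q → Step (qs u) a q → Disabled u a ⊎ ∃[ v ] qs v ≡ q × Includes u a v

    record Enumerates (k : ℕ) : Set₁ where
      field
        sound    : ∀ u → Reach k (qs u) (Is u)
        complete : ∀ {q I} → Reach k q I → ∃[ u ] qs u ≡ q × Is u ≐ᴵ I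

    -- The nodes of this stage need not belong to the exploration, but by soundness their successors
    -- consist of covered states, so `exploration-⊇` applies to them.
    enumerates-closed : Enumerates (exploration-bound .proj₁) → Closed
    enumerates-closed enum u a q s with em {∃[ J ] Is u ⇒[ a ] J}
    ... | no ¬J = inj₁ λ J I⇒J → ¬J (J , I⇒J)
    ... | yes (J , I⇒J) =
      let I , n∈ , J⊆I = exploration-⊇ {q} {J} (reach-sound (step {J = J} (Enumerates.sound enum u) s I⇒J))
          v , qv≡q , Iv≐I = Enumerates.complete enum (exploration-bound .proj₂ n∈)
      in inj₂ (v , qv≡q , λ K I⇒K x∈ → Iv≐I .proj₂ (J⊆I (⇒-mono {Is u} {Is u} {a} {K} {J} id I⇒K I⇒J x∈)))

    -- The additional mark, set everywhere, forces cycles to be nonempty.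
    marks⁺ : Fin r → Subset (suc conditions)
    marks⁺ u = inside Vec.∷ marks (qs u)

    FairCycle : Fin r → Word → Set₁
    FairCycle v w = Σ[ p ∈ Exact.Walk v w v ] ∀ c → Exact.Visits (λ u → c ∈ˢ marks⁺ u) p

    PositiveCycle : Fin r → Set₁
    PositiveCycle v = ∃[ w ] FairCycle v w × PositiveWord w

    exact-⇒* : ∀ {u w v} → Exact.Walk u w v → Is u ⇒*[ w ] Is v
    exact-⇒* []            = Ŝ.[]
    exact-⇒* ((_ , e) ∷ p) = e Ŝ.∷ exact-⇒* p

    HasMark : Fin (suc conditions) → Config → Set
    HasMark c (q , _) = c ∈ˢ (inside Vec.∷ marks q)

    exact-joint : ∀ {u w v x y} → Exact.Walk u w v → x ⟶*[ w ] y → Joint.Walk (qs u , x) w (qs v , y)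
    exact-joint []            []      = []
    exact-joint ((s , _) ∷ p) (e ∷ q) = (s , e) ∷ exact-joint p q

    exact-joint-visits : ∀ {c u w v x y} (p : Exact.Walk u w v) (q : x ⟶*[ w ] y) →
      Exact.Visits (λ u → c ∈ˢ marks⁺ u) p → Joint.Visits (HasMark c) (exact-joint p q)
    exact-joint-visits (_ ∷ p) (_ ∷ q) (here c∈) = here c∈
    exact-joint-visits (_ ∷ p) (_ ∷ q) (there v) = there (exact-joint-visits p q v)

    counterexample : ∀ {k v} → Reach k (qs v) (Is v) → PositiveCycle v → Counterexample
    counterexample {v = v} reach (w , (p , fair) , w-positive)
      with z , z∈ ← isIdeal (Is v) .nonempty
      -- Exactness makes `w` map `Is v` to itself, so any element of `Is v` yields a source in
      -- `Is v` at which `w` is enabled.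
      with x , y , x∈ , x→y , _ ← ⇒*-preimage (exact-⇒* p) z∈
      with q₀ , u , x′ , init , toCycle , x≤x′ ← reach-sound reach x∈
      = word∞ start , (proj₂ ∘ vertices start , refl , proj₂ ∘ isInfiniteWalk start)
      , proj₁ ∘ vertices start , init , proj₁ ∘ isInfiniteWalk start
      , λ c i → let j , i≤j , c∈ = infinitelyOften (suc c) start i in j , i≤j , Subset.drop-there c∈
      where
      Inv : Config → Set
      Inv (q , x) = q ≡ qs v × ∃[ y ] x ⟶*[ w ] y

      toLap : ∀ {x w′ z} (p : Exact.Walk v w′ v) → (∀ c → Exact.Visits (λ u → c ∈ˢ marks⁺ u) p) →
        x ⟶*[ w′ ] z → Inv (qs v , z) → Joint.Lap HasMark Inv (qs v , x)
      -- Mark `zero` exists even without acceptance conditions, and an empty walk visits no mark.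
      toLap []        fair []       _   with () ← fair zero
      toLap p@(_ ∷ _) fair q@(_ ∷ _) inv with exact-joint p q | (λ c → exact-joint-visits p q (fair c))
      ... | e ∷ rest | visits = record { edge = e ; rest = rest ; visits = visits ; invariant = inv }

      -- Positivity ends the lap above its starting state, where strong monotonicity enables `w`
      -- again.
      lap : ∀ {c} → Inv c → Joint.Lap HasMark Inv c
      lap {_ , x} (refl , enabled@(_ , x→)) =
        let z , x→z , x≤z = w-positive x enabled
            _ , z→ , _ = monotone* stronglyMonotone x→ x≤z
        in toLap p fair x→z (refl , _ , z→)

      open Joint.Unroll lap

      start : Position
      start = toCycle to (refl , let y′ , x′→ , _ = monotone* stronglyMonotone x→y x≤x′ in y′ , x′→)

    -- Following an accepted trace through the family, some u recurs with
    -- x ≤ x′ below Is u.  Positivity of the word read in between implies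
    -- that it maps Is u onto itself, and strict monotonicity that no step
    -- in between loses anything.
    module Completeness (positive : IsPositive) (closed : Closed)
      (rooted : ∀ q → Initial q → ∃[ u ] qs u ≡ q × x₀ ∈ carrier (Is u)) (ce : Counterexample) where

      σ = ce .proj₁
      xs = ce .proj₂ .proj₁ .proj₁
      xs₀ = ce .proj₂ .proj₁ .proj₂ .proj₁
      moves = ce .proj₂ .proj₁ .proj₂ .proj₂
      ρ = ce .proj₂ .proj₂ .proj₁
      ρ₀ = ce .proj₂ .proj₂ .proj₂ .proj₁
      steps = ce .proj₂ .proj₂ .proj₂ .proj₂ .proj₁
      fair = ce .proj₂ .proj₂ .proj₂ .proj₂ .proj₂

      Tracked : ℕ → Set
      Tracked i = ∃[ u ] qs u ≡ ρ i × xs i ∈ carrier (Is u)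

      track : ∀ i (t : Tracked i) → Σ[ t′ ∈ Tracked (suc i) ] Includes (proj₁ t) (σ i) (proj₁ t′)
      track i (u , qu≡ , x∈)
        with J , I⇒J , y∈ ← successor (Is u) x∈ (moves i)
        with closed u (σ i) (ρ (suc i)) (subst (λ q → Step q (σ i) (ρ (suc i))) (sym qu≡) (steps i))
      ... | inj₁ disabled         = contradiction I⇒J (disabled J)
      ... | inj₂ (v , qv≡ , incl) = (v , qv≡ , incl J I⇒J y∈) , incl

      tracked : ∀ i → Tracked i
      tracked zero    = let u , qu≡ , x₀∈ = rooted (ρ 0) ρ₀ in u , qu≡ , subst (_∈ carrier (Is u)) (sym xs₀) x₀∈
      tracked (suc i) = track i (tracked i) .proj₁

      us : ℕ → Fin r
      us = proj₁ ∘ tracked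

      met : ∀ c n → ∃[ j ] n ℕ.≤ j × c ∈ˢ (inside Vec.∷ marks (ρ j))
      met zero    n = n , ℕ.≤-refl , Vec.here
      met (suc c) n = let j , n≤j , c∈ = fair c n in j , n≤j , Vec.there c∈

      -- The successor is needed because `Visits` ignores the end of a walk: all marks must be met
      -- strictly before it.
      allMet : ℕ → ℕ
      allMet n = suc (upperBound (λ c → met c n .proj₁) .proj₁)

      met-< : ∀ c n → met c n .proj₁ ℕ.< allMet n
      met-< c n = s≤s (upperBound (λ c → met c n .proj₁) .proj₂ c)

      module Loop (b n : ℕ) (same : us (n + b) ≡ us b) (increasing : xs b ≤ xs (n + b)) where

        -- The exact completion run from `Is (us b)` along the trace, to be compared with the
        -- possibly larger nodes `target k` through which the trace is tracked.
        Images : ∀ k → Σ[ J ∈ Ideal ] xs (k + b) ∈ carrier J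
        Images zero    = Is (us b) , tracked b .proj₂ .proj₂
        Images (suc k) = let J , _ , x∈ = successor (Images k .proj₁) (Images k .proj₂) (moves (k + b)) in J , x∈

        image : ℕ → Ideal
        image = proj₁ ∘ Images

        image-⇒ : ∀ k → image k ⇒[ σ (k + b) ] image (suc k)
        image-⇒ k = successor (Images k .proj₁) (Images k .proj₂) (moves (k + b)) .proj₂ .proj₁

        target : ℕ → Ideal
        target k = Is (us (k + b))

        target-⇒ : ∀ k → ∃[ K ] target k ⇒[ σ (k + b) ] K × K ⊆ᴵ target (suc k)
        target-⇒ k =
          let K , ⇒K , _ = successor (target k) (tracked (k + b) .proj₂ .proj₂) (moves (k + b))
          in K , ⇒K , track (k + b) (tracked (k + b)) .proj₂ K ⇒K

        image-⊆ : ∀ k → image k ⊆ᴵ target k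
        image-⊆ zero    = id
        image-⊆ (suc k) x∈ =
          let K , ⇒K , K⊆ = target-⇒ k
          in K⊆ (⇒-mono {image k} {target k} {_} {image (suc k)} {K} (image-⊆ k) (image-⇒ k) ⇒K x∈)

        w : Word
        w = slice (λ k → σ (k + b)) n

        path : xs b ⟶*[ w ] xs (n + b)
        path = take-path (λ k → xs (k + b)) _ (λ k → moves (k + b)) n

        w-positive : PositiveWord w
        w-positive = positive w (xs b , xs (n + b) , path , increasing)

        -- Since `target n` is `Is (us b)`, an element `x` of it has a bound `y` there that is also
        -- above `xs b`. Monotonicity enables `w` at `y`, and positivity leads to some `y′` above
        -- `y`, which lies in `image n`.
        image-⊇ : target n ⊆ᴵ image n
        image-⊇ x∈ =
          let y , y∈ , x≤y , xb≤y = isIdeal (Is (us b)) .directed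
                (subst (λ u → _ ∈ carrier (Is u)) same x∈) (tracked b .proj₂ .proj₂)
              z , y→z , _ = monotone* stronglyMonotone path xb≤y
              y′ , y→y′ , y≤y′ = w-positive y (z , y→z)
          in down (image n) (≤-trans x≤y y≤y′) (⇒*-image (Pathsᶜ.take-path image _ image-⇒ n) y∈ y→y′)

        -- A gap between image and target, once opened, survives to the end: strict monotonicity
        -- separates the successors, and the next target is at least the successor of the present
        -- one.
        strict : ∀ {k} → k ℕ.≤‴ n → image k ⊂ᴵ target k → image n ⊂ᴵ target n
        strict ℕ.≤‴-refl             ⊂k = ⊂k
        strict {k} (ℕ.≤‴-step k<n) ⊂k = strict k<n
          ( image-⊆ (suc k)
          , λ ⊆image → let K , ⇒K , K⊆ = target-⇒ k in
              ⇒*-strict {image k} {target k} {[ _ ]} {image (suc k)} {K} ⊂k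
                (Ŝ._∷_ {z = image (suc k)} (image-⇒ k) Ŝ.[]) (Ŝ._∷_ {z = K} ⇒K Ŝ.[]) .proj₂ (λ x∈ → ⊆image (K⊆ x∈)) )

        -- A gap at `k` would persist up to `n`, where `image-⊇` leaves none.
        target-⊆ : ∀ {k} → k ℕ.≤ n → target k ⊆ᴵ image k
        target-⊆ {k} k≤n = ⊆-stable {target k} {image k} λ ⊈ →
          strict (ℕ.≤⇒≤‴ k≤n) (image-⊆ k , ⊈) .proj₂ image-⊇

        exact : ∀ k → k ℕ.< n → ExactEdge (us (k + b)) (σ (k + b)) (us (suc k + b))
        exact k k<n = step′ , post⇒ {target k} {_} {target (suc k)}
          ( (λ x∈ → post-mono {image k} {target k} (image-⊆ k) (image-⇒ k .proj₁ (target-⊆ k<n x∈)))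
          , (λ x∈ → let K , ⇒K , K⊆ = target-⇒ k in K⊆ (⇒post {target k} {_} {K} ⇒K .proj₂ x∈)) )
          where
          step′ : Step (qs (us (k + b))) (σ (k + b)) (qs (us (suc k + b)))
          step′ = subst₂ (λ q r → Step q (σ (k + b)) r)
            (sym (tracked (k + b) .proj₂ .proj₁)) (sym (tracked (suc k + b) .proj₂ .proj₁)) (steps (k + b))

        fairCycle : allMet b ℕ.≤ n + b → FairCycle (us b) w
        fairCycle allMet≤ = subst (λ v → Σ[ p ∈ Exact.Walk (us b) w v ] ∀ c → Exact.Visits (λ u → c ∈ˢ marks⁺ u) p)
          same (Exact.take-walk (λ k → us (k + b)) _ n exact , visits)
          where
          visits : ∀ c → Exact.Visits (λ u → c ∈ˢ marks⁺ u) (Exact.take-walk (λ k → us (k + b)) _ n exact)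
          visits c with j , b≤j , c∈ ← met c b | j< ← met-< c b =
            Exact.take-visits (λ k → us (k + b)) _ n exact {j ℕ.∸ b}
              (ℕ.+-cancelʳ-< b (j ℕ.∸ b) n (subst (ℕ._< n + b) (sym (ℕ.m∸n+n≡m b≤j)) (ℕ.≤-trans j< allMet≤)))
              (subst (λ i → c ∈ˢ marks⁺ (us i)) (sym (ℕ.m∸n+n≡m b≤j))
                (subst (λ q → c ∈ˢ (inside Vec.∷ marks q)) (sym (tracked j .proj₂ .proj₁)) c∈))

      positiveCycle : ∃[ v ] PositiveCycle v
      positiveCycle =
        let open Iterate allMet (met-< zero)
            p = iterate 0
            -- Sampling at iterates of `allMet` ensures that every mark is met between any two
            -- samples.
            i , j , i<j , same , increasing = wqo-pair {R = _≤_} (isWSTS .proj₁) (us ∘ p) (xs ∘ p)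
            p<p : allMet (p i) ℕ.≤ p j
            p<p = iterate-< 0 i<j
            n = p j ℕ.∸ p i
            n+ : p j ≡ n + p i
            n+ = sym (ℕ.m∸n+n≡m (ℕ.<⇒≤ (ℕ.≤-trans (met-< zero (p i)) p<p)))
            module L = Loop (p i) n (subst (λ m → us m ≡ us (p i)) n+ (sym same))
                         (subst (λ m → xs (p i) ≤ xs m) n+ increasing)
        in us (p i) , L.w , L.fairCycle (subst (allMet (p i) ℕ.≤_) n+ p<p) , L.w-positive

-- The algorithm

words : ∀ {n} → ℕ → List (List (Fin n))
words zero    = [ [] ]
words (suc k) = [] ∷ cartesianProductWith _∷_ (allFin _) (words k)

∈-words⁺ : ∀ {n k} {w : List (Fin n)} → length w ℕ.≤ k → w ∈ˡ words k
∈-words⁺ {k = zero}  {[]}    _         = here refl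
∈-words⁺ {k = suc k} {[]}    _         = here refl
∈-words⁺ {k = suc k} {a ∷ w} (s≤s w≤k) = there (∈-cartesianProductWith⁺ _∷_ (∈-allFin a) (∈-words⁺ w≤k))

∈-words⁻ : ∀ {n} k {w : List (Fin n)} → w ∈ˡ words k → length w ℕ.≤ k
∈-words⁻ zero    (here refl) = z≤n
∈-words⁻ (suc k) (here refl) = z≤n
∈-words⁻ (suc k) (there w∈) with _ , _ , _ , v∈ , refl ← ∈-cartesianProductWith⁻ _∷_ (allFin _) (words k) w∈ =
  s≤s (∈-words⁻ k v∈)

module Algorithm (𝒞 : Class) (𝒫 : Procedures 𝒞) (S : Class.Name 𝒞)
  (A : Automaton (Class.Sys.∣Σ∣ 𝒞 S)) (x₀ : Class.Sys.State 𝒞 S) where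
  open Class 𝒞
  open Procedures 𝒫
  open Automaton A

  Letter : Set
  Letter = Sys.Letter S

  NodeCode : Set
  NodeCode = Fin size × IdealCode S

  stepsᴾ : NodeCode → Partial (List NodeCode)
  stepsᴾ (q , i) = concatMapᴾ
    (λ a → post S i a >>=ᴾ λ js → returnᴾ (cartesianProduct (filter (step? q a) (allFin size)) js))
    (allFin (Sys.∣Σ∣ S))

  accelsᴾ : ℕ → NodeCode → Partial (List NodeCode)
  accelsᴾ k (q , i) = concatMapᴾ
    (λ w → accel S w i >>=ᴾ λ j → returnᴾ [ q , j ])
    (filter (λ w → walk? step? q w q) (words k))

  reachᴾ : ℕ → Partial (List NodeCode)
  reachᴾ zero    = principal S x₀ >>=ᴾ λ i → returnᴾ (map (_, i) (filter initial? (allFin size)))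
  reachᴾ (suc k) = reachᴾ k >>=ᴾ λ R → concatMapᴾ stepsᴾ R >>=ᴾ λ P → concatMapᴾ (accelsᴾ k) R >>=ᴾ λ Q →
    returnᴾ (R ++ P ++ Q)

  module Nodes (R : List NodeCode) where
    r : ℕ
    r = length R

    state : Fin r → Fin size
    state u = lookup R u .proj₁

    code : Fin r → IdealCode S
    code u = lookup R u .proj₂

    disabledᴾ : Fin r → Letter → Partial Bool
    disabledᴾ u a = post S (code u) a >>=ᴾ λ js → returnᴾ (null js)

    -- By determinism all listed successors are the same ideal, so the head decides. An empty list
    -- makes inclusion vacuous and exactness false.
    includesᴾ exactᴾ : Fin r → Letter → Fin r → Partial Bool
    includesᴾ u a v = post S (code u) a >>=ᴾ λ
      { []      → returnᴾ true
      ; (j ∷ _) → included S j (code v) }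
    exactᴾ u a v = post S (code u) a >>=ᴾ λ
      { []      → returnᴾ false
      ; (j ∷ _) → included S j (code v) >>=ᴾ λ b → included S (code v) j >>=ᴾ λ c → returnᴾ (b ∧ c) }

    IsClosed : (Fin r → Letter → Bool) → (Fin r → Letter → Fin r → Bool) → Set
    IsClosed disabled includes = ∀ u a q → Step (state u) a q →
      T (disabled u a) ⊎ ∃[ v ] state v ≡ q × T (includes u a v)

    closed? : ∀ disabled includes → Dec (IsClosed disabled includes)
    closed? disabled includes = all? λ u → all? λ a → all? λ q → step? (state u) a q →-dec
      (T? (disabled u a) ⊎-dec any? λ v → state v ≟ q ×-dec T? (includes u a v))

    Edge : (Fin r → Letter → Fin r → Bool) → Fin r → Letter → Fin r → Set
    Edge exact u a v = Step (state u) a (state v) × T (exact u a v)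

    edge? : ∀ exact u a v → Dec (Edge exact u a v)
    edge? exact u a v = step? (state u) a (state v) ×-dec T? (exact u a v)

    module Cycles (exact : Fin r → Letter → Fin r → Bool) =
      CycleNFA (edge? exact) (λ u → inside Vec.∷ marks (state u))

    tabulate² : (Fin r → Letter → Partial Bool) → Partial (Fin r → Letter → Bool)
    tabulate² f = tabulateᴾ λ u → tabulateᴾ (f u)

    tabulate³ : (Fin r → Letter → Fin r → Partial Bool) → Partial (Fin r → Letter → Fin r → Bool)
    tabulate³ f = tabulateᴾ λ u → tabulateᴾ λ a → tabulateᴾ (f u a)

    noPositiveCycleᴾ : Partial Bool
    noPositiveCycleᴾ = tabulate³ exactᴾ >>=ᴾ λ exact →
      tabulateᴾ (λ v → positive S (Cycles.nfa exact v)) >>=ᴾ λ positives →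
      returnᴾ (notᵇ ⌊ any? (T? ∘ positives) ⌋)

    -- The answer `nothing` sends the search on to other stages: a family that is not closed could
    -- miss counterexamples.
    verdictᴾ : Partial (Maybe Bool)
    verdictᴾ = tabulate² disabledᴾ >>=ᴾ λ disabled → tabulate³ includesᴾ >>=ᴾ λ includes →
      if ⌊ closed? disabled includes ⌋
        then (noPositiveCycleᴾ >>=ᴾ λ b → returnᴾ (just b))
        else returnᴾ nothing

  noAcceptedTraceᴾ : Partial Bool
  noAcceptedTraceᴾ = searchᴾ λ k → reachᴾ k >>=ᴾ Nodes.verdictᴾ

-- Correctness and termination of the algorithm.

module Correctness (em : ExcludedMiddle (lsuc 0ℓ)) (𝒞 : Class) (𝒫 : Procedures 𝒞) (S : Class.Name 𝒞)
  (veryWSTS : Class.Sys.IsVeryWSTS 𝒞 S) (positive-system : Class.Sys.IsPositive 𝒞 S)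
  (effective : Effectiveness.CompletionPostEffective 𝒞 𝒫) (∞-effective : Effectiveness.∞-CompletionEffective 𝒞 𝒫)
  (positive-effective : Effectiveness.PositiveEffective 𝒞 𝒫)
  (A : Automaton (Class.Sys.∣Σ∣ 𝒞 S)) (x₀ : Class.Sys.State 𝒞 S) where

  open Class 𝒞 using (module Sys; system)
  open Procedures 𝒫 using (IdealCode; ⟦_⟧)
  open Effectiveness 𝒞 𝒫
  open CompletionPostEffective effective using (principal-spec; included-spec; post-spec)
  open Algorithm 𝒞 𝒫 S A x₀ hiding (Letter)
  open Automaton A
  open Ideals em (system S) veryWSTS
  open ProductSystem em (system S) veryWSTS A x₀

  ⟪_⟫ : IdealCode S → Ideal
  ⟪ i ⟫ = CompletionPostEffective.ideal effective S i

  ⇒-source : ∀ {I J a K} → I ≐ᴵ J → I ⇒[ a ] K → J ⇒[ a ] K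
  ⇒-source {I} {J} {a} {K} (I⊆J , J⊆I) I⇒K = post⇒ {J} {a} {K}
    ( (λ x∈ → post-mono {I} {J} I⊆J (⇒post {I} {a} {K} I⇒K .proj₁ x∈))
    , (λ x∈ → ⇒post {I} {a} {K} I⇒K .proj₂ (post-mono {J} {I} J⊆I x∈)) )

  -- The computation depends only on the code `i`, so its output serves every ideal with the same
  -- carrier; the ideals in `Reach` are known only up to that equality.
  accel-computes : ∀ w i → Procedures.accel 𝒫 S w i Computes λ j → ∀ I → carrier I ≐ ⟦ i ⟧ → ⟦ j ⟧ ≐ w ^∞ I
  accel-computes w i .halts               = ∞-effective S w i ⟪ i ⟫ (id , id) .halts
  accel-computes w i .correct n j eq I I≐ = ∞-effective S w i I I≐ .correct n j eq

  StepsSpec : NodeCode → Pred (List NodeCode) (lsuc 0ℓ)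
  StepsSpec (q , i) R =
    (∀ {r j} → (r , j) ∈ˡ R → ∃[ a ] Step q a r × ⟪ i ⟫ ⇒[ a ] ⟪ j ⟫) ×
    (∀ {r J} a → Step q a r → ⟪ i ⟫ ⇒[ a ] J → ∃[ j ] (r , j) ∈ˡ R × ⟪ j ⟫ ≐ᴵ J)

  steps-computes : ∀ n → stepsᴾ n Computes StepsSpec n
  steps-computes (q , i) = weaken spec (concatMap-computes {P = LetterSpec} letter-computes (allFin ∣Σ∣))
    where
    LetterSpec : Letter → Pred (List NodeCode) (lsuc 0ℓ)
    LetterSpec a R =
      (∀ {r j} → (r , j) ∈ˡ R → Step q a r × ⟪ i ⟫ ⇒[ a ] ⟪ j ⟫) ×
      (∀ {r J} → Step q a r → ⟪ i ⟫ ⇒[ a ] J → ∃[ j ] (r , j) ∈ˡ R × ⟪ j ⟫ ≐ᴵ J)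

    letter-computes : ∀ a → _ Computes LetterSpec a
    letter-computes a = >>=-computes (post-spec S i a) λ {js} (sound , complete) → return-computes
      ( (λ r∈ → let r∈′ , j∈ = ∈-cartesianProduct⁻ (filter (step? q a) (allFin size)) js r∈
                in ∈-filter⁻ (step? q a) {xs = allFin size} r∈′ .proj₂ , All.lookup sound j∈)
      , (λ {r} {J} s ⇒J → let j , j∈ , j≐ = findˡ (complete J ⇒J)
                in j , ∈-cartesianProduct⁺ (∈-filter⁺ (step? q a) (∈-allFin r) s) j∈ , j≐) )

    spec : Collects LetterSpec (allFin ∣Σ∣) ⊆ StepsSpec (q , i)
    spec (to , from) =
      (λ r∈ → let a , R , _ , (sound , _) , r∈R = from r∈ in a , sound r∈R) ,
      (λ {_} {J} a s ⇒J →
        let R , (_ , complete) , R⊆ = to (∈-allFin a)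
            j , r∈ , j≐ = complete {J = J} s ⇒J
        in j , R⊆ _ r∈ , j≐)

  AccelsSpec : ℕ → NodeCode → Pred (List NodeCode) (lsuc 0ℓ)
  AccelsSpec k (q , i) R =
    (∀ {r j} → (r , j) ∈ˡ R → ∃[ w ] length w ℕ.≤ k × Walks.Walk Step q w q × r ≡ q × ⟦ j ⟧ ≐ w ^∞ ⟪ i ⟫) ×
    (∀ {w} I → carrier I ≐ ⟦ i ⟧ → length w ℕ.≤ k → Walks.Walk Step q w q → ∃[ j ] (q , j) ∈ˡ R × ⟦ j ⟧ ≐ w ^∞ I)

  accels-computes : ∀ k n → accelsᴾ k n Computes AccelsSpec k n
  accels-computes k (q , i) = weaken spec (concatMap-computes {P = WordSpec} word-computes (filter loop? (words k)))
    where
    loop? = λ w → walk? step? q w q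

    WordSpec : Word → Pred (List NodeCode) (lsuc 0ℓ)
    WordSpec w R = ∃[ j ] R ≡ [ q , j ] × (∀ I → carrier I ≐ ⟦ i ⟧ → ⟦ j ⟧ ≐ w ^∞ I)

    word-computes : ∀ w → _ Computes WordSpec w
    word-computes w = >>=-computes (accel-computes w i) λ {j} j≐ → return-computes (j , refl , j≐)

    spec : Collects WordSpec (filter loop? (words k)) ⊆ AccelsSpec k (q , i)
    spec {R} (to , from) = sound , complete
      where
      sound : ∀ {r j} → (r , j) ∈ˡ R → ∃[ w ] length w ℕ.≤ k × Walks.Walk Step q w q × r ≡ q × ⟦ j ⟧ ≐ w ^∞ ⟪ i ⟫
      sound r∈ with w , _ , w∈ , (j , refl , j≐) , here refl ← from r∈ =
        let w∈′ , ρ = ∈-filter⁻ loop? {xs = words k} w∈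
        in w , ∈-words⁻ k w∈′ , ρ , refl , j≐ ⟪ i ⟫ (id , id)

      complete : ∀ {w} I → carrier I ≐ ⟦ i ⟧ → length w ℕ.≤ k → Walks.Walk Step q w q → ∃[ j ] (q , j) ∈ˡ R × ⟦ j ⟧ ≐ w ^∞ I
      complete I I≐ w≤k ρ with _ , (j , refl , j≐) , R⊆ ← to (∈-filter⁺ loop? (∈-words⁺ w≤k) ρ) =
        j , R⊆ _ (here refl) , j≐ I I≐

  ReachSpec : ℕ → Pred (List NodeCode) (lsuc 0ℓ)
  ReachSpec k R =
    (∀ {q i} → (q , i) ∈ˡ R → Reach k q ⟪ i ⟫) ×
    (∀ {q I} → Reach k q I → ∃[ i ] (q , i) ∈ˡ R × ⟪ i ⟫ ≐ᴵ I)

  reach-computes : ∀ k → reachᴾ k Computes ReachSpec k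
  reach-computes zero = >>=-computes (principal-spec S x₀) λ {i} (i⊆ , ⊆i) → return-computes
    ( sound i (i⊆ , ⊆i)
    , λ { (root init (I⊆ , ⊆I)) → i , ∈-map⁺ (_, i) (∈-filter⁺ initial? (∈-allFin _) init)
                                 , (λ x∈ → ⊆I (i⊆ x∈)) , λ x∈ → ⊆i (I⊆ x∈) } )
    where
    sound : ∀ i → ⟦ i ⟧ ≐ (_≤ x₀) → ∀ {q j} → (q , j) ∈ˡ map (_, i) (filter initial? (allFin size)) → Reach 0 q ⟪ j ⟫
    sound i i≐ q∈ with _ , q∈′ , refl ← ∈-map⁻ (_, i) q∈ =
      root (∈-filter⁻ initial? {xs = allFin size} q∈′ .proj₂) i≐
  reach-computes (suc k) = >>=-computes (reach-computes k) λ {R} R-spec →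
    >>=-computes (concatMap-computes steps-computes R) λ {P} P-spec →
    >>=-computes (concatMap-computes (accels-computes k) R) λ {Q} Q-spec →
    return-computes (spec R-spec P-spec Q-spec)
    where
    spec : ∀ {R P Q} → ReachSpec k R → Collects StepsSpec R P → Collects (AccelsSpec k) R Q → ReachSpec (suc k) (R ++ P ++ Q)
    spec {R} {P} {Q} (R-sound , R-complete) (P-to , P-from) (Q-to , Q-from) = sound , complete
      where
      sound : ∀ {q i} → (q , i) ∈ˡ R ++ P ++ Q → Reach (suc k) q ⟪ i ⟫
      sound n∈ with ∈-++⁻ R n∈
      ... | inj₁ n∈R = keep (R-sound n∈R)
      ... | inj₂ n∈PQ with ∈-++⁻ P n∈PQ
      ...   | inj₁ n∈P =
        let m , _ , m∈ , (steps-sound , _) , n∈ = P-from n∈P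
            a , s , e = steps-sound n∈
        in step (R-sound m∈) s e
      ...   | inj₂ n∈Q with m , _ , m∈ , (accels-sound , _) , n∈ ← Q-from n∈Q
                       with w , w≤k , ρ , refl , j≐ ← accels-sound n∈ = accel (R-sound m∈) w≤k ρ j≐

      complete : ∀ {q I} → Reach (suc k) q I → ∃[ i ] (q , i) ∈ˡ R ++ P ++ Q × ⟪ i ⟫ ≐ᴵ I
      complete (keep n) = let i , n∈ , i≐ = R-complete n in i , ∈-++⁺ˡ n∈ , i≐
      complete (step {I = I} {a = a} {J = J} n s I⇒J) =
        let i , n∈ , (i⊆ , ⊆i) = R-complete n
            _ , (_ , steps-complete) , P⊆ = P-to n∈
            j , m∈ , j≐ = steps-complete {J = J} a s (⇒-source {I} {⟪ i ⟫} {a} {J} (⊆i , i⊆) I⇒J)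
        in j , ∈-++⁺ʳ R (∈-++⁺ˡ (P⊆ _ m∈)) , j≐
      complete (accel {I = I} n w≤k ρ (J⊆ , ⊆J)) =
        let i , n∈ , (i⊆ , ⊆i) = R-complete n
            _ , (_ , accels-complete) , Q⊆ = Q-to n∈
            j , m∈ , (j⊆ , ⊆j) = accels-complete I (⊆i , i⊆) w≤k ρ
        in j , ∈-++⁺ʳ R (∈-++⁺ʳ P (Q⊆ _ m∈)) , (λ x∈ → ⊆J (j⊆ x∈)) , λ x∈ → ⊆j (J⊆ x∈)

  module NodesCorrectness {k : ℕ} {R : List NodeCode} (R-spec : ReachSpec k R) where
    open Nodes R hiding (Edge)
    open Family state (⟪_⟫ ∘ code) public

    enumerates : Enumerates k
    enumerates = record
      { sound    = λ u → R-spec .proj₁ (∈-lookup u)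
      ; complete = λ {_} {I} n → let i , n∈ , i≐ = R-spec .proj₂ n in locate {I = I} n∈ i≐
      }
      where
      locate : ∀ {q i I} → (q , i) ∈ˡ R → ⟪ i ⟫ ≐ᴵ I → ∃[ u ] state u ≡ q × ⟪ code u ⟫ ≐ᴵ I
      locate {I = I} n∈ i≐ = index n∈ , cong proj₁ (sym (lookup-index n∈)) ,
        subst (λ n → ⟪ n .proj₂ ⟫ ≐ᴵ I) (lookup-index n∈) i≐

    disabled-decides : ∀ u a → disabledᴾ u a Decides Disabled u a
    disabled-decides u a = >>=-computes (post-spec S (code u) a) λ
      { {[]}    (_ , complete)  → return-computes (ofʸ λ J ⇒J → case complete J ⇒J of λ ())
      ; {j ∷ _} (⇒j ∷ _ , _) → return-computes (ofⁿ λ ¬J → ¬J ⟪ j ⟫ ⇒j) }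

    includes-decides : ∀ u a v → includesᴾ u a v Decides Includes u a v
    includes-decides u a v = >>=-computes (post-spec S (code u) a) λ
      { {[]}    (_ , complete)  → return-computes (ofʸ λ J ⇒J → case complete J ⇒J of λ ())
      ; {j ∷ _} (⇒j ∷ _ , _) → weaken
          (Reflects-map {A = ⟦ j ⟧ ⊆ ⟦ code v ⟧}
            (λ j⊆v J ⇒J x∈ → j⊆v (⇒-mono {⟪ code u ⟫} {⟪ code u ⟫} {a} {J} {⟪ j ⟫} id ⇒J ⇒j x∈))
            (λ incl → incl ⟪ j ⟫ ⇒j))
          (included-spec S j (code v)) }

    exact-decides : ∀ u a v → exactᴾ u a v Decides (⟪ code u ⟫ ⇒[ a ] ⟪ code v ⟫)
    exact-decides u a v = >>=-computes (post-spec S (code u) a) λ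
      { {[]}    (_ , complete)  → return-computes (ofⁿ λ ⇒v → case complete ⟪ code v ⟫ ⇒v of λ ())
      ; {j ∷ _} (⇒j ∷ _ , _) →
          >>=-computes (included-spec S j (code v)) λ j⊆v →
          >>=-computes (included-spec S (code v) j) λ v⊆j →
          return-computes (Reflects-map {A = ⟦ j ⟧ ⊆ ⟦ code v ⟧ × ⟦ code v ⟧ ⊆ ⟦ j ⟧}
            (from j ⇒j) (to j ⇒j) (j⊆v ×-reflects v⊆j)) }
      where
      from : ∀ j → ⟪ code u ⟫ ⇒[ a ] ⟪ j ⟫ → ⟦ j ⟧ ⊆ ⟦ code v ⟧ × ⟦ code v ⟧ ⊆ ⟦ j ⟧ → ⟪ code u ⟫ ⇒[ a ] ⟪ code v ⟫
      from j ⇒j (j⊆v , v⊆j) = post⇒ {⟪ code u ⟫} {a} {⟪ code v ⟫}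
        ( (λ x∈ → ⇒post {⟪ code u ⟫} {a} {⟪ j ⟫} ⇒j .proj₁ (v⊆j x∈))
        , (λ x∈ → j⊆v (⇒post {⟪ code u ⟫} {a} {⟪ j ⟫} ⇒j .proj₂ x∈)) )

      to : ∀ j → ⟪ code u ⟫ ⇒[ a ] ⟪ j ⟫ → ⟪ code u ⟫ ⇒[ a ] ⟪ code v ⟫ → ⟦ j ⟧ ⊆ ⟦ code v ⟧ × ⟦ code v ⟧ ⊆ ⟦ j ⟧
      to j ⇒j ⇒v = completionDeterministic {⟪ code u ⟫} {⟪ j ⟫} {⟪ code v ⟫} ⇒j ⇒v

    noPositiveCycle-decides : noPositiveCycleᴾ Decides (¬ (∃[ v ] PositiveCycle v))
    noPositiveCycle-decides =
      >>=-computes (tabulate-computes λ u → tabulate-computes λ a → tabulate-computes (exact-decides u a))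
        λ {exact} exact-spec →
      >>=-computes (tabulate-computes λ v → positive-effective S (Cycles.nfa exact v)) λ {positives} positives-spec →
      return-computes (¬-reflects (conclude exact exact-spec positives positives-spec))
      where
      module _ (exact : Fin r → Letter → Fin r → Bool)
        (exact-spec : ∀ u a v → Reflects (⟪ code u ⟫ ⇒[ a ] ⟪ code v ⟫) (exact u a v))
        (positives : Fin r → Bool)
        (positives-spec : ∀ v → Reflects (∃[ w ] w ∈ NFA.Language (Cycles.nfa exact v) × PositiveWord w) (positives v)) where

        toExact : ∀ {u a v} → Nodes.Edge R exact u a v → ExactEdge u a v
        toExact {u} {a} {v} (s , e) = s , reflects-from (exact-spec u a v) (Equivalence.to T-≡ e)

        fromExact : ∀ {u a v} → ExactEdge u a v → Nodes.Edge R exact u a v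
        fromExact {u} {a} {v} (s , e) = s , Equivalence.from T-≡ (reflects-to (exact-spec u a v) e)

        conclude : Reflects (∃[ v ] PositiveCycle v) ⌊ any? (T? ∘ positives) ⌋
        conclude = fromEquivalence
          (λ Tany → let v , Tv = toWitness Tany
                        w , w∈ , w-pos = reflects-from (positives-spec v) (Equivalence.to T-≡ Tv)
                        p , fair = Cycles.cycle⁻ exact v w∈
                    in v , w , (map-walk toExact p , λ c → map-visits toExact (fair c)) , w-pos)
          (λ (v , w , (p , fair) , w-pos) → fromWitness (v , Equivalence.from T-≡ (reflects-to (positives-spec v)
            (w , Cycles.cycle⁺ exact v (map-walk fromExact p) (λ c → map-visits fromExact (fair c)) , w-pos))))

    rooted : ∀ q → Initial q → ∃[ u ] state u ≡ q × x₀ ∈ ⟦ code u ⟧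
    rooted q init with u , qu≡q , (_ , ⊇↓x₀) ← Enumerates.complete enumerates
                         (reach-mono {0} {k} {q} {↓ᴵ x₀} z≤n (root init (id , id))) = u , qu≡q , ⊇↓x₀ ≤-refl

    noCounterexample-decides : Closed → noPositiveCycleᴾ Decides (¬ Counterexample)
    noCounterexample-decides closed = weaken
      (Reflects-map
        (λ ¬cycle ce → ¬cycle (Completeness.positiveCycle positive-system closed rooted ce))
        (λ ¬ce (v , cycle) → ¬ce (counterexample (Enumerates.sound enumerates v) cycle)))
      noPositiveCycle-decides

    -- Recording why a stage was rejected is what lets termination rule out rejection.
    data Verdict : Maybe Bool → Set₁ where
      open-nodes   : ¬ Closed → Verdict nothing
      closed-nodes : ∀ {b} → Reflects (¬ Counterexample) b → Verdict (just b)

    verdict-computes : verdictᴾ Computes Verdict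
    verdict-computes =
      >>=-computes (tabulate-computes λ u → tabulate-computes (disabled-decides u)) λ {disabled} disabled-spec →
      >>=-computes (tabulate-computes λ u → tabulate-computes λ a → tabulate-computes (includes-decides u a))
        λ {includes} includes-spec →
      conclude disabled disabled-spec includes includes-spec
      where
      module _ (disabled : Fin r → Letter → Bool) (disabled-spec : ∀ u a → Reflects (Disabled u a) (disabled u a))
        (includes : Fin r → Letter → Fin r → Bool) (includes-spec : ∀ u a v → Reflects (Includes u a v) (includes u a v)) where

        conclude : (if ⌊ closed? disabled includes ⌋
          then (noPositiveCycleᴾ >>=ᴾ λ b → returnᴾ (just b))
          else returnᴾ nothing) Computes Verdict
        conclude with closed? disabled includes
        ... | yes closed = >>=-computes (noCounterexample-decides λ u a q s →
                [ (λ d → inj₁ (reflects-from (disabled-spec u a) (Equivalence.to T-≡ d)))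
                , (λ (v , qv≡q , i) → inj₂ (v , qv≡q , reflects-from (includes-spec u a v) (Equivalence.to T-≡ i)))
                ]′ (closed u a q s)) λ b-spec → return-computes (closed-nodes b-spec)
        ... | no ¬closed = return-computes (open-nodes λ closed → ¬closed λ u a q s →
                [ (λ d → inj₁ (Equivalence.from T-≡ (reflects-to (disabled-spec u a) d)))
                , (λ (v , qv≡q , i) → inj₂ (v , qv≡q , Equivalence.from T-≡ (reflects-to (includes-spec u a v) i)))
                ]′ (closed u a q s))

  noAcceptedTrace-decides : noAcceptedTraceᴾ Decides (¬ Counterexample)
  noAcceptedTrace-decides = search-computes {P = Outcome}
    (λ k → >>=-computes (reach-computes k) λ {R} R-spec →
      weaken (λ v → R , R-spec , v) (NodesCorrectness.verdict-computes R-spec))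
    (λ { (R , R-spec , NodesCorrectness.closed-nodes b-spec) → b-spec })
    -- This stage contains the whole exploration, hence is closed and cannot be rejected.
    (exploration-bound .proj₁ , λ { (R , R-spec , NodesCorrectness.open-nodes ¬closed) →
      ¬closed (NodesCorrectness.enumerates-closed R-spec (NodesCorrectness.enumerates R-spec)) })
    where
    Outcome : ℕ → Pred (Maybe Bool) (lsuc 0ℓ)
    Outcome k v = Σ[ R ∈ List NodeCode ] Σ[ R-spec ∈ ReachSpec k R ] NodesCorrectness.Verdict R-spec v

theorem20 : (𝒞 : Class) (𝒫 : Procedures 𝒞) (let open Class 𝒞) (let open Effectiveness 𝒞 𝒫) →
    Σ[ modelCheck ∈ ((S : Name) → Sys.State S → LTL (Sys.∣Σ∣ S) → Partial Bool) ]
      (ExcludedMiddle (lsuc 0ℓ) →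
       (∀ S → Sys.IsVeryWSTS S) →
       (∀ S → Sys.IsPositive S) →
       CompletionPostEffective →
       ∞-CompletionEffective →
       PositiveEffective →
       ∀ (S : Name) (x₀ : Sys.State S) (φ : LTL (Sys.∣Σ∣ S)) →
         modelCheck S x₀ φ Decides
           ((σ : ℕ → Sys.Letter S) → Sys.IsInfiniteTrace S x₀ σ → σ ⊨ φ))
theorem20 𝒞 𝒫 =
  (λ S x₀ φ → Algorithm.noAcceptedTraceᴾ 𝒞 𝒫 S (Tableau.violations φ) x₀) ,
  λ em veryWSTS positive effective ∞-effective positive-effective S x₀ φ →
    let em₀ = Classical.em₀ em in
    weaken
      (Reflects-map
        -- Refuting accepted traces gives `φ` only up to double negation.
        (λ ¬ce σ trace → decidable-stable em₀ λ σ⊭φ → ¬ce (σ , trace , Tableau.violations-complete em₀ φ σ⊭φ))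
        (λ all (σ , trace , accepted) → Tableau.violations-sound φ accepted (all σ trace)))
      (Correctness.noAcceptedTrace-decides em 𝒞 𝒫 S (veryWSTS S) (positive S) effective ∞-effective positive-effective
        (Tableau.violations φ) x₀)
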